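{- Let $c,d$ be constants with $c>10$. Let $G$ be a $d$-regular $c$-expander on $n$ vertices where $n$ is odd, and let $b\in\{0,1\}^n$ be the all-1s vector. Then all SubCubeSums refutations of the Tseitin contradiction corresponding to $G,b$ require combinatorial size exponential in $n$; that is, there are $\varepsilon>0$ and $n_0$, depending only on $c$ and $d$, such that for every such $G$ with $n\ge n_0$, every SubCubeSums refutation has combinatorial size at least $2^{\varepsilon n}$.
   Context: A graph $G=(V,E)$ is a $c$-expander if for all $V'\subseteq V$ with $|V'|\le|V|/2$, $|\delta(V')|\ge c|V'|$, where $\delta(V')=\{(u,v)\in E\mid u\in V',v\in V\setminus V'\}$. Tseitin contradiction for $G,b$ (with $\sum_u b_u\equiv1\bmod2$): one variable $x_e$ per edge $e$; for each vertex $u$ of degree $d_u$ a set $S_u$ of $2^{d_u-1}$ clauses of width $d_u$, one for each assignment to $\{x_e: e\ni u\}$ with parity $\ne b_u$, falsified exactly by that assignment; together they express $\sum_{e\ni u}x_e\equiv b_u\bmod 2$. For a multi-set $F$ of clauses and a total assignment $\alpha$, $\mathrm{viol}_F(\alpha)$ is the number of clauses of $F$ (with multiplicity) falsified by $\alpha$. A SubCubeSums refutation of an unsatisfiable CNF $F$ over variables $X$ is a multi-set $\mathcal{C}$ of non-tautologous clauses over $X$ with $\mathrm{viol}_F(\alpha)=1+\mathrm{viol}_{\mathcal{C}}(\alpha)$ for all $\alpha\in\{0,1\}^X$. Its combinatorial size is the number of clauses of $\mathcal{C}$ counted with multiplicity. -}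

module Defs where

open import Data.Bool using (Bool; true; false; not; _xor_)
import Data.Bool.Properties as Bool
open import Data.Fin using (Fin) renaming (_<_ to _<ᶠ_)
import Data.Fin.Properties as Fin
open import Data.Fin.Subset using (Subset; _∈_; _∉_; ∣_∣)
open import Data.Fin.Subset.Properties using (_∈?_)
open import Data.Integer using (+_)
import Data.Integer as ℤ
open import Data.List using (List; []; _∷_; [_]; map; concatMap; filter; foldr; length; allFin)
open import Data.List.Relation.Unary.All using (All; all?)
import Data.List.Membership.Propositional as List
open import Data.Nat using (ℕ; _+_; _*_; _^_; _≤_)
open import Data.Product using (_×_; _,_; proj₁; proj₂; ∃; ∃-syntax)
open import Data.Rational using (ℚ; ↥_; ↧ₙ_; _/_) renaming (_<_ to _<ℚ_; _≤_ to _≤ℚ_; _*_ to _*ℚ_)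
open import Data.Sum using (_⊎_)
open import Function.Bundles using (_⇔_)
open import Function.Definitions using (Injective)
open import Relation.Binary.PropositionalEquality using (_≡_; _≢_)
open import Relation.Nullary using (¬_; ¬?)
open import Relation.Nullary.Decidable using (_×-dec_; _⊎-dec_)
open import Relation.Unary using (Decidable)

-- Real numbers as two-sided Dedekind cuts of ℚ: Lower q means q < x, and
-- Upper q means x < q.
record ℝ : Set₁ where
  field
    Lower Upper     : ℚ → Set
    lower-inhabited : ∃ Lower
    upper-inhabited : ∃ Upper
    lower-rounded   : ∀ q → Lower q ⇔ (∃[ r ] q <ℚ r × Lower r)
    upper-rounded   : ∀ q → Upper q ⇔ (∃[ r ] r <ℚ q × Upper r)
    disjoint        : ∀ q → ¬ (Lower q × Upper q)
    located         : ∀ {q r} → q <ℚ r → Lower q ⊎ Upper r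

infix 4 _<ℝ_
_<ℝ_ : ℚ → ℝ → Set
q <ℝ x = ℝ.Lower x q

-- x k ≤ m in ℝ. As k ≥ 0, this holds iff q k ≤ m for every rational q < x.
infix 4 _·_≤ℝ_
_·_≤ℝ_ : ℝ → ℕ → ℕ → Set
x · k ≤ℝ m = ∀ q → q <ℝ x → q *ℚ (+ k / 1) ≤ℚ (+ m / 1)

-- 2 ^ (ε n) ≤ s for a rational ε ≥ 0, both sides being raised to the power of
-- the denominator of ε. Only meaningful for ε ≥ 0.
infix 4 2^[_·_]≤_
2^[_·_]≤_ : ℚ → ℕ → ℕ → Set
2^[ ε · n ]≤ s = 2 ^ (ℤ.∣ ↥ ε ∣ * n) ≤ s ^ ↧ₙ ε

-- Finite simple undirected graphs on the vertex set Fin n. The edges are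
-- enumerated by Fin #E; the edge {u , v} with u < v is stored as (u , v).
record Graph (n : ℕ) : Set where
  field
    #E        : ℕ
    ends      : Fin #E → Fin n × Fin n
    ordered   : ∀ e → proj₁ (ends e) <ᶠ proj₂ (ends e)
    injective : Injective _≡_ _≡_ ends

module _ {n : ℕ} (G : Graph n) where
  open Graph G

  Incident : Fin n → Fin #E → Set
  Incident u e = u ≡ proj₁ (ends e) ⊎ u ≡ proj₂ (ends e)

  incident? : ∀ u → Decidable (Incident u)
  incident? u e = (u Fin.≟ proj₁ (ends e)) ⊎-dec (u Fin.≟ proj₂ (ends e))

  incidentEdges : Fin n → List (Fin #E)
  incidentEdges u = filter (incident? u) (allFin #E)

  degree : Fin n → ℕ
  degree u = length (incidentEdges u)

  Regular : ℕ → Set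
  Regular d = ∀ u → degree u ≡ d

  Crosses : Subset n → Fin #E → Set
  Crosses V′ e = (proj₁ (ends e) ∈ V′ × proj₂ (ends e) ∉ V′)
               ⊎ (proj₂ (ends e) ∈ V′ × proj₁ (ends e) ∉ V′)

  crosses? : ∀ V′ → Decidable (Crosses V′)
  crosses? V′ e =
          ((proj₁ (ends e) ∈? V′) ×-dec ¬? (proj₂ (ends e) ∈? V′))
    ⊎-dec ((proj₂ (ends e) ∈? V′) ×-dec ¬? (proj₁ (ends e) ∈? V′))

  δ : Subset n → List (Fin #E)
  δ V′ = filter (crosses? V′) (allFin #E)

  Expander : ℝ → Set
  Expander c = ∀ (V′ : Subset n) → 2 * ∣ V′ ∣ ≤ n → c · ∣ V′ ∣ ≤ℝ length (δ V′)

-- (x , true) is the literal x and (x , false) is its negation.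
Literal : ℕ → Set
Literal m = Fin m × Bool

Clause : ℕ → Set
Clause m = List (Literal m)

-- Lists stand for multisets of clauses.
CNF : ℕ → Set
CNF m = List (Clause m)

Assignment : ℕ → Set
Assignment m = Fin m → Bool

Tautologous : ∀ {m} → Clause m → Set
Tautologous C = ∃[ x ] ((x , true) List.∈ C) × ((x , false) List.∈ C)

Falsifies : ∀ {m} → Assignment m → Clause m → Set
Falsifies α = All (λ (x , s) → α x ≢ s)

falsifies? : ∀ {m} (α : Assignment m) → Decidable (Falsifies α)
falsifies? α = all? (λ (x , s) → ¬? (α x Bool.≟ s))

viol : ∀ {m} → CNF m → Assignment m → ℕ
viol F α = length (filter (falsifies? α) F)

-- All assignments to the variables in a duplicate-free list, as graphs.
localAssignments : ∀ {m} → List (Fin m) → List (List (Fin m × Bool))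
localAssignments []       = [ [] ]
localAssignments (x ∷ xs) =
  concatMap (λ ρ → ((x , false) ∷ ρ) ∷ ((x , true) ∷ ρ) ∷ []) (localAssignments xs)

parity : ∀ {m} → List (Fin m × Bool) → Bool
parity = foldr (λ (_ , v) p → v xor p) false

-- The clause falsified exactly by the extensions of ρ.
forbid : ∀ {m} → List (Fin m × Bool) → Clause m
forbid = map (λ (x , v) → (x , not v))

module _ {n : ℕ} (G : Graph n) (b : Fin n → Bool) where
  open Graph G

  vertexClauses : Fin n → CNF #E
  vertexClauses u =
    map forbid (filter (λ ρ → ¬? (parity ρ Bool.≟ b u)) (localAssignments (incidentEdges G u)))

  Tseitin : CNF #E
  Tseitin = concatMap vertexClauses (allFin n)

-- Unsatisfiability of F is not a separate field: the identity gives viol F α ≥ 1.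
record SubCubeSumsRefutation {m : ℕ} (F : CNF m) : Set where
  field
    clauses         : CNF m
    non-tautologous : All (λ C → ¬ Tautologous C) clauses
    identity        : ∀ α → viol F α ≡ 1 + viol clauses α

  size : ℕ
  size = length clauses

{-# OPTIONS --safe #-}
module Submission where

-- An assignment falsifies one Tseitin clause for each vertex it violates, so on the
-- assignments whose set U of violated vertices has 1, 3 or 5 elements, a refutation has 0, 2
-- or 4 falsified clauses. Write N C U for the number of assignments with violated set U that
-- falsify C. Flipping an edge not in C shows that N C U does not change when two vertices
-- connected by edges outside C are toggled in U. For C = [] this makes N [] U the same number
-- K for all odd U.
--
-- By expansion a clause C with fewer than 2n variables leaves a component with at least 4n/5
-- vertices. Sum N C over ordered triples and over ordered 5-tuples: deleting a pair of
-- entries in the giant component turns a 5-tuple into a triple with the same N C, and a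
-- 5-tuple with four entries there reduces to a singleton, where N C vanishes. So each 5-tuple
-- arises in at most 3 of the 10 positions of a pair, and (5-tuples) ≥ (10/3) (16/25) n²
-- (triples). The factor 32/15 exceeds 2, the ratio of the totals over all clauses, which are
-- about 4 K n⁵ and 2 K n³. Hence clauses with at least 2n variables carry a constant fraction
-- of the triples; but such a clause is falsified by at most 2^(#E - 2n) ≤ 2^(-n) K
-- assignments, because the 2^#E assignments fall into at most 2ⁿ sets of size at most K.

open import Defs
open import Data.Bool using (Bool; true; false; not; _∧_; T)
import Data.Bool.Properties as Bool
open import Data.Empty using (⊥; ⊥-elim)
open import Data.Fin using (Fin; zero; suc; toℕ; fromℕ<)
import Data.Fin.Properties as Fin
open import Data.Fin.Subset using (Subset; ∣_∣)
import Data.Fin.Subset as Subset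
import Data.Integer as ℤ
import Data.Integer.Properties as ℤ
open import Data.List using (List; []; _∷_; [_]; _++_; map; concatMap; filter; foldr; length; allFin)
import Data.List as List
open import Data.List.Membership.Propositional using (_∈_; _∉_)
import Data.List.Membership.DecPropositional as DecMembership
open import Data.List.Membership.Propositional.Properties using (∈-allFin; ∈-filter⁺; ∈-filter⁻; ∈-map⁺; ∈-++⁺ˡ; ∈-++⁺ʳ)
open import Data.List.Properties using (length-tabulate)
open import Data.List.Relation.Binary.Permutation.Propositional using (_↭_; prep; swap)
import Data.List.Relation.Binary.Permutation.Propositional as Perm
open import Data.List.Relation.Binary.Permutation.Propositional.Properties using (∷↭∷ʳ)
import Data.List.Relation.Unary.All as All
open import Data.List.Relation.Unary.AllPairs using (_∷_)
open import Data.List.Relation.Unary.Any using (here; there)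
open import Data.List.Relation.Unary.Unique.Propositional using (Unique)
open import Data.List.Relation.Unary.Unique.Propositional.Properties using (allFin⁺; filter⁺)
open import Data.Nat using (ℕ; zero; suc; _+_; _*_; _^_; _≤_; _<_; _≥_; _≡ᵇ_; _<ᵇ_; z≤n; s≤s; NonZero; >-nonZero)
open import Data.Nat.DivMod using (_%_)
import Data.Nat.Properties as ℕ
open import Data.Nat.Solver using (module +-*-Solver)
open import Data.Product using (_×_; _,_; proj₁; proj₂; ∃-syntax)
open import Data.Rational using (Positive; _/_) renaming (_*_ to _*ℚ_; _≤_ to _≤ℚ_)
import Data.Rational.Properties as ℚ
import Data.Rational.Unnormalised as ℚᵘ
import Data.Rational.Unnormalised.Properties as ℚᵘ
open import Data.Sum using (_⊎_; inj₁; inj₂; [_,_]′)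
open import Data.Vec using (Vec; []; _∷_; _∷ʳ_; lookup; updateAt; tabulate; replicate; toList)
import Data.Vec.Properties as Vec
open import Function using (_∘_; id)
open import Function.Bundles using (mk⇔)
open import Relation.Binary.PropositionalEquality using (_≡_; _≢_; refl; sym; trans; cong; cong₂; subst; module ≡-Reasoning)
open import Relation.Nullary using (¬_; ¬?; Dec; yes; no; does; contradiction)
open import Relation.Nullary.Decidable using (_×-dec_; _⊎-dec_; dec-true; does-⇔; from-yes; map′)
open import Relation.Unary using (Decidable)

open +-*-Solver using (Polynomial; solve; con; _:+_; _:*_; _:=_)

private
  variable
    A B : Set
    m n : ℕ

-- Finite sums and Boolean vectors

∑ : List A → (A → ℕ) → ℕ
∑ []       f = 0
∑ (x ∷ xs) f = f x + ∑ xs f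

infixr 5 ∑
syntax ∑ xs (λ x → e) = ∑[ x ∈ xs ] e

∑-cong : ∀ (xs : List A) {f g : A → ℕ} → (∀ x → f x ≡ g x) → ∑ xs f ≡ ∑ xs g
∑-cong []       eq = refl
∑-cong (x ∷ xs) eq = cong₂ _+_ (eq x) (∑-cong xs eq)

∑-mono-∈ : ∀ (xs : List A) {f g : A → ℕ} → (∀ x → x ∈ xs → f x ≤ g x) → ∑ xs f ≤ ∑ xs g
∑-mono-∈ []       le = z≤n
∑-mono-∈ (x ∷ xs) le = ℕ.+-mono-≤ (le x (here refl)) (∑-mono-∈ xs λ y → le y ∘ there)

∑-mono : ∀ (xs : List A) {f g : A → ℕ} → (∀ x → f x ≤ g x) → ∑ xs f ≤ ∑ xs g
∑-mono xs le = ∑-mono-∈ xs λ x _ → le x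

∑-const : ∀ (xs : List A) c → ∑ xs (λ _ → c) ≡ length xs * c
∑-const []       c = refl
∑-const (_ ∷ xs) c = cong (c +_) (∑-const xs c)

∑-*ˡ : ∀ (xs : List A) c f → ∑ xs (λ x → c * f x) ≡ c * ∑ xs f
∑-*ˡ []       c f = sym (ℕ.*-zeroʳ c)
∑-*ˡ (x ∷ xs) c f = trans (cong (c * f x +_) (∑-*ˡ xs c f)) (sym (ℕ.*-distribˡ-+ c (f x) _))

∑-*ʳ : ∀ (xs : List A) c f → ∑ xs (λ x → f x * c) ≡ ∑ xs f * c
∑-*ʳ xs c f = begin
  ∑ xs (λ x → f x * c) ≡⟨ ∑-cong xs (λ x → ℕ.*-comm (f x) c) ⟩
  ∑ xs (λ x → c * f x) ≡⟨ ∑-*ˡ xs c f ⟩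
  c * ∑ xs f           ≡⟨ ℕ.*-comm c _ ⟩
  ∑ xs f * c           ∎
  where open ≡-Reasoning

+-interchange : ∀ a b c d → (a + b) + (c + d) ≡ (a + c) + (b + d)
+-interchange = solve 4 (λ a b c d → (a :+ b) :+ (c :+ d) := (a :+ c) :+ (b :+ d)) refl

∑-+ : ∀ (xs : List A) f g → ∑ xs (λ x → f x + g x) ≡ ∑ xs f + ∑ xs g
∑-+ []       f g = refl
∑-+ (x ∷ xs) f g = trans (cong (f x + g x +_) (∑-+ xs f g)) (+-interchange (f x) _ _ _)

∑-swap : ∀ (xs : List A) (ys : List B) (f : A → B → ℕ) →
         ∑[ x ∈ xs ] ∑[ y ∈ ys ] f x y ≡ ∑[ y ∈ ys ] ∑[ x ∈ xs ] f x y
∑-swap []       ys f = sym (trans (∑-const ys 0) (ℕ.*-zeroʳ (length ys)))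
∑-swap (x ∷ xs) ys f = trans (cong (∑ ys (f x) +_) (∑-swap xs ys f)) (sym (∑-+ ys (f x) _))

∑-++ : ∀ (xs ys : List A) f → ∑ (xs ++ ys) f ≡ ∑ xs f + ∑ ys f
∑-++ []       ys f = refl
∑-++ (x ∷ xs) ys f = trans (cong (f x +_) (∑-++ xs ys f)) (sym (ℕ.+-assoc (f x) _ _))

∑-map : ∀ (h : A → B) xs f → ∑ (map h xs) f ≡ ∑ xs (f ∘ h)
∑-map h []       f = refl
∑-map h (x ∷ xs) f = cong (f (h x) +_) (∑-map h xs f)

∑-concatMap : ∀ (h : A → List B) xs f → ∑ (concatMap h xs) f ≡ ∑[ x ∈ xs ] ∑ (h x) f
∑-concatMap h []       f = refl
∑-concatMap h (x ∷ xs) f =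
  trans (∑-++ (h x) (concatMap h xs) f) (cong (∑ (h x) f +_) (∑-concatMap h xs f))

∑-∈ : ∀ {xs : List A} f {x} → x ∈ xs → f x ≤ ∑ xs f
∑-∈ f (here refl)  = ℕ.m≤m+n _ _
∑-∈ f (there x∈xs) = ℕ.≤-trans (∑-∈ f x∈xs) (ℕ.m≤n+m _ _)

⟦_⟧ : Bool → ℕ
⟦ true ⟧  = 1
⟦ false ⟧ = 0

⟦⟧≤1 : ∀ b → ⟦ b ⟧ ≤ 1
⟦⟧≤1 true  = s≤s z≤n
⟦⟧≤1 false = z≤n

⟦⟧-mono : ∀ {P Q : Set} (P? : Dec P) (Q? : Dec Q) → (P → Q) → ⟦ does P? ⟧ ≤ ⟦ does Q? ⟧
⟦⟧-mono (no _)  Q? P⇒Q = z≤n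
⟦⟧-mono (yes p) Q? P⇒Q rewrite dec-true Q? (P⇒Q p) = s≤s z≤n

length-filter : ∀ {P : A → Set} (P? : Decidable P) xs →
                length (filter P? xs) ≡ ∑[ x ∈ xs ] ⟦ does (P? x) ⟧
length-filter P? [] = refl
length-filter P? (x ∷ xs) with does (P? x)
... | true  = cong suc (length-filter P? xs)
... | false = length-filter P? xs

∑-filter : ∀ {P : A → Set} (P? : Decidable P) xs f →
           ∑ (filter P? xs) f ≡ ∑[ x ∈ xs ] ⟦ does (P? x) ⟧ * f x
∑-filter P? [] f = refl
∑-filter P? (x ∷ xs) f with does (P? x)
... | true  = cong₂ _+_ (sym (ℕ.+-identityʳ (f x))) (∑-filter P? xs f)
... | false = ∑-filter P? xs f

∑-allFin-suc : ∀ n (f : Fin (suc n) → ℕ) → ∑ (allFin (suc n)) f ≡ f zero + ∑ (allFin n) (f ∘ suc)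
∑-allFin-suc n f = cong (f zero +_) (∑-tabulate n suc f)
  where
  ∑-tabulate : ∀ {A : Set} n (h : Fin n → A) f → ∑ (List.tabulate h) f ≡ ∑ (allFin n) (f ∘ h)
  ∑-tabulate zero    h f = refl
  ∑-tabulate (suc n) h f = cong (f (h zero) +_)
    (trans (∑-tabulate n (h ∘ suc) f) (sym (∑-tabulate n suc (f ∘ h))))

∑-≟ : ∀ {n} (a : Fin n) → ∑[ b ∈ allFin n ] ⟦ does (a Fin.≟ b) ⟧ ≡ 1
∑-≟ {suc n} zero    = trans (∑-allFin-suc n (λ b → ⟦ does (zero Fin.≟ b) ⟧))
  (cong suc (trans (∑-const (allFin n) 0) (ℕ.*-zeroʳ (length (allFin n)))))
∑-≟ {suc n} (suc a) = trans (∑-allFin-suc n (λ b → ⟦ does (suc a Fin.≟ b) ⟧)) (∑-≟ a)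

_≟ⱽ_ : (u v : Vec Bool n) → Dec (u ≡ v)
_≟ⱽ_ = Vec.≡-dec Bool._≟_

-- Assignments and vertex sets are vectors, so that they can be listed and compared; `lookup v`
-- turns one back into an assignment.
allVecs : ∀ n → List (Vec Bool n)
allVecs zero    = [ [] ]
allVecs (suc n) = map (false ∷_) (allVecs n) ++ map (true ∷_) (allVecs n)

∈-allVecs : (v : Vec Bool n) → v ∈ allVecs n
∈-allVecs []          = here refl
∈-allVecs (false ∷ v) = ∈-++⁺ˡ (∈-map⁺ (false ∷_) (∈-allVecs v))
∈-allVecs (true ∷ v)  = ∈-++⁺ʳ _ (∈-map⁺ (true ∷_) (∈-allVecs v))

∑-allVecs-suc : ∀ n f →
  ∑ (allVecs (suc n)) f ≡ ∑ (allVecs n) (f ∘ (false ∷_)) + ∑ (allVecs n) (f ∘ (true ∷_))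
∑-allVecs-suc n f = trans (∑-++ (map (false ∷_) (allVecs n)) _ f)
  (cong₂ _+_ (∑-map (false ∷_) (allVecs n) f) (∑-map (true ∷_) (allVecs n) f))

∑-allVecs-const : ∀ n c → ∑[ _ ∈ allVecs n ] c ≡ 2 ^ n * c
∑-allVecs-const zero    c = refl
∑-allVecs-const (suc n) c = begin
  ∑ (allVecs (suc n)) (λ _ → c) ≡⟨ ∑-allVecs-suc n (λ _ → c) ⟩
  s + s                         ≡⟨ cong₂ _+_ (∑-allVecs-const n c) (∑-allVecs-const n c) ⟩
  2 ^ n * c + 2 ^ n * c         ≡⟨ solve 2 (λ p c → p :* c :+ p :* c := (p :+ (p :+ con 0)) :* c) refl (2 ^ n) c ⟩
  2 ^ suc n * c                 ∎
  where
  open ≡-Reasoning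
  s = ∑ (allVecs n) (λ _ → c)

flip : Fin n → Vec Bool n → Vec Bool n
flip i v = updateAt v i not

flip-involutive : ∀ (i : Fin n) v → flip i (flip i v) ≡ v
flip-involutive i v = trans (Vec.updateAt-updateAt i v)
  (Vec.updateAt-id-local i v (Bool.not-involutive _))

flip-comm : ∀ (i j : Fin n) v → flip i (flip j v) ≡ flip j (flip i v)
flip-comm zero    zero    (b ∷ v) = refl
flip-comm zero    (suc j) (b ∷ v) = refl
flip-comm (suc i) zero    (b ∷ v) = refl
flip-comm (suc i) (suc j) (b ∷ v) = cong (b ∷_) (flip-comm i j v)

lookup-flip : ∀ (i : Fin n) v → lookup (flip i v) i ≡ not (lookup v i)
lookup-flip i v = Vec.lookup∘updateAt i v

lookup-flip-≢ : ∀ {i j : Fin n} → i ≢ j → ∀ v → lookup (flip j v) i ≡ lookup v i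
lookup-flip-≢ {i = i} {j} i≢j v = Vec.lookup∘updateAt′ i j i≢j v

-- Toggling a coordinate permutes the cube: the first coordinate exchanges the two halves, a later
-- one acts inside each half.
∑-flip : ∀ (i : Fin n) f → ∑ (allVecs n) f ≡ ∑ (allVecs n) (f ∘ flip i)
∑-flip {suc n} zero f = begin
  ∑ (allVecs (suc n)) f                                         ≡⟨ ∑-allVecs-suc n f ⟩
  ∑ (allVecs n) (f ∘ (false ∷_)) + ∑ (allVecs n) (f ∘ (true ∷_)) ≡⟨ ℕ.+-comm (∑ (allVecs n) (f ∘ (false ∷_))) _ ⟩
  ∑ (allVecs n) (f ∘ (true ∷_)) + ∑ (allVecs n) (f ∘ (false ∷_)) ≡⟨ ∑-allVecs-suc n (f ∘ flip zero) ⟨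
  ∑ (allVecs (suc n)) (f ∘ flip zero)                           ∎
  where open ≡-Reasoning
∑-flip {suc n} (suc i) f = begin
  ∑ (allVecs (suc n)) f
    ≡⟨ ∑-allVecs-suc n f ⟩
  ∑ (allVecs n) (f ∘ (false ∷_)) + ∑ (allVecs n) (f ∘ (true ∷_))
    ≡⟨ cong₂ _+_ (∑-flip i (f ∘ (false ∷_))) (∑-flip i (f ∘ (true ∷_))) ⟩
  ∑ (allVecs n) (f ∘ (false ∷_) ∘ flip i) + ∑ (allVecs n) (f ∘ (true ∷_) ∘ flip i)
    ≡⟨ ∑-allVecs-suc n (f ∘ flip (suc i)) ⟨
  ∑ (allVecs (suc n)) (f ∘ flip (suc i))
    ∎
  where open ≡-Reasoning

count : Vec Bool n → ℕ
count []      = 0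
count (b ∷ v) = ⟦ b ⟧ + count v

-- The term `2 * ⟦ lookup v i ⟧` avoids subtraction: a toggle adds an element or removes one that
-- was present.
count-flip : ∀ (i : Fin n) v → count (flip i v) + 2 * ⟦ lookup v i ⟧ ≡ suc (count v)
count-flip zero    (true ∷ v)  = ℕ.+-comm (count v) 2
count-flip zero    (false ∷ v) = cong suc (ℕ.+-identityʳ (count v))
count-flip (suc i) (b ∷ v)     = begin
  ⟦ b ⟧ + count (flip i v) + 2 * ⟦ lookup v i ⟧   ≡⟨ ℕ.+-assoc ⟦ b ⟧ _ _ ⟩
  ⟦ b ⟧ + (count (flip i v) + 2 * ⟦ lookup v i ⟧) ≡⟨ cong (⟦ b ⟧ +_) (count-flip i v) ⟩
  ⟦ b ⟧ + suc (count v)                           ≡⟨ ℕ.+-suc ⟦ b ⟧ _ ⟩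
  suc (⟦ b ⟧ + count v)                           ∎
  where open ≡-Reasoning

count-tabulate : ∀ n (f : Fin n → Bool) → count (tabulate f) ≡ ∑[ i ∈ allFin n ] ⟦ f i ⟧
count-tabulate zero    f = refl
count-tabulate (suc n) f =
  trans (cong (⟦ f zero ⟧ +_) (count-tabulate n (f ∘ suc))) (sym (∑-allFin-suc n (⟦_⟧ ∘ f)))

-- The sum over 𝔽₂ of the unit vectors of a list.
ind : List (Fin n) → Vec Bool n
ind = foldr flip (replicate _ false)

count-replicate : ∀ n → count (replicate n false) ≡ 0
count-replicate zero    = refl
count-replicate (suc n) = count-replicate n

count-ind : ∀ (xs : List (Fin n)) → count (ind xs) ≤ length xs
count-ind {n} []   = ℕ.≤-reflexive (count-replicate n)
count-ind (x ∷ xs) = begin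
  count (flip x (ind xs))                             ≤⟨ ℕ.m≤m+n _ _ ⟩
  count (flip x (ind xs)) + 2 * ⟦ lookup (ind xs) x ⟧ ≡⟨ count-flip x (ind xs) ⟩
  suc (count (ind xs))                                ≤⟨ s≤s (count-ind xs) ⟩
  suc (length xs)                                     ∎
  where open ℕ.≤-Reasoning

-- Only an inequality, because repeated entries cancel modulo 2.
lookup-ind-∷ : ∀ (a b : Fin n) xs →
  ⟦ lookup (ind (b ∷ xs)) a ⟧ ≤ ⟦ does (a Fin.≟ b) ⟧ + ⟦ lookup (ind xs) a ⟧
lookup-ind-∷ a b xs with a Fin.≟ b
... | yes _  = ℕ.≤-trans (⟦⟧≤1 _) (s≤s z≤n)
... | no a≢b = ℕ.≤-reflexive (cong ⟦_⟧ (lookup-flip-≢ a≢b (ind xs)))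

lookup-ind-[] : ∀ (a : Fin n) → ⟦ lookup (ind []) a ⟧ ≡ 0
lookup-ind-[] a = cong ⟦_⟧ (Vec.lookup-replicate a false)

ind-map-suc : ∀ (xs : List (Fin n)) → ind (map suc xs) ≡ false ∷ ind xs
ind-map-suc []       = refl
ind-map-suc (x ∷ xs) = cong (flip (suc x)) (ind-map-suc xs)

-- Lets bounds proved by deleting list entries reach every vertex set.
ind-surjective : (v : Vec Bool n) → ∃[ xs ] ind xs ≡ v
ind-surjective []          = [] , refl
ind-surjective (false ∷ v) = let xs , eq = ind-surjective v in
  map suc xs , trans (ind-map-suc xs) (cong (false ∷_) eq)
ind-surjective (true ∷ v)  = let xs , eq = ind-surjective v in
  zero ∷ map suc xs , cong (flip zero) (trans (ind-map-suc xs) (cong (false ∷_) eq))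

-- Falsified clauses

restrict : Vec Bool m → List (Fin m) → List (Fin m × Bool)
restrict v = map (λ x → x , lookup v x)

restrict-flip-∉ : ∀ {e : Fin m} v xs → e ∉ xs → restrict (flip e v) xs ≡ restrict v xs
restrict-flip-∉ v []       e∉ = refl
restrict-flip-∉ v (x ∷ xs) e∉ = cong₂ _∷_
  (cong (x ,_) (lookup-flip-≢ (e∉ ∘ here ∘ sym) v)) (restrict-flip-∉ v xs (e∉ ∘ there))

-- As `xs` is duplicate-free, exactly one summand of the parity changes.
parity-flip-∈ : ∀ {e : Fin m} v xs → Unique xs → e ∈ xs →
                parity (restrict (flip e v) xs) ≡ not (parity (restrict v xs))
parity-flip-∈ v (x ∷ xs) (x∉xs ∷ _) (here refl)
  rewrite lookup-flip x v
        | restrict-flip-∉ v xs (λ x∈xs → All.lookup x∉xs x∈xs refl) =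
  sym (Bool.not-distribˡ-xor (lookup v x) _)
parity-flip-∈ v (x ∷ xs) (x∉xs ∷ xs!) (there e∈xs)
  rewrite lookup-flip-≢ (All.lookup x∉xs e∈xs) v
        | parity-flip-∈ v xs xs! e∈xs =
  sym (Bool.not-distribʳ-xor (lookup v x) _)

-- Only the restriction of v to xs is a local assignment whose clause v falsifies.
∑-forbid : ∀ (v : Vec Bool m) xs (f : List (Fin m × Bool) → ℕ) →
  ∑[ ρ ∈ localAssignments xs ] (f ρ * ⟦ does (falsifies? (lookup v) (forbid ρ)) ⟧) ≡ f (restrict v xs)
∑-forbid v []       f = trans (ℕ.+-identityʳ _) (ℕ.*-identityʳ _)
∑-forbid {m} v (x ∷ xs) f = trans (∑-concatMap _ (localAssignments xs) _)
  (trans (∑-cong (localAssignments xs) step) (∑-forbid v xs (f ∘ ((x , lookup v x) ∷_))))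
  where
  F : List (Fin m × Bool) → ℕ
  F ρ = ⟦ does (falsifies? (lookup v) (forbid ρ)) ⟧
  step : ∀ ρ → f ((x , false) ∷ ρ) * F ((x , false) ∷ ρ) + (f ((x , true) ∷ ρ) * F ((x , true) ∷ ρ) + 0)
             ≡ f ((x , lookup v x) ∷ ρ) * F ρ
  step ρ with lookup v x
  ... | true  = trans (cong (_+ (f ((x , true) ∷ ρ) * F ρ + 0)) (ℕ.*-zeroʳ (f ((x , false) ∷ ρ)))) (ℕ.+-identityʳ _)
  ... | false = trans (cong (λ z → f ((x , false) ∷ ρ) * F ρ + (z + 0)) (ℕ.*-zeroʳ (f ((x , true) ∷ ρ)))) (ℕ.+-identityʳ _)

viol-∑ : ∀ (F : CNF m) α → viol F α ≡ ∑[ C ∈ F ] ⟦ does (falsifies? α C) ⟧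
viol-∑ F α = length-filter (falsifies? α) F

vars : Clause m → List (Fin m)
vars = map proj₁

module _ {m : ℕ} where
  open DecMembership (Fin._≟_ {m}) public using (_∈?_)

-- Distinct variables are counted, since a clause is a list and may repeat a literal.
width : Clause m → ℕ
width {m} C = ∑[ e ∈ allFin m ] ⟦ does (e ∈? vars C) ⟧

falsifies-flip : ∀ {e : Fin m} v C → e ∉ vars C →
  does (falsifies? (lookup (flip e v)) C) ≡ does (falsifies? (lookup v) C)
falsifies-flip v []            e∉ = refl
falsifies-flip v ((x , s) ∷ C) e∉
  rewrite lookup-flip-≢ (e∉ ∘ here ∘ sym) v =
  cong (not (does (lookup v x Bool.≟ s)) ∧_) (falsifies-flip v C (e∉ ∘ there))

falsified : Clause m → ℕ
falsified {m} C = ∑[ v ∈ allVecs m ] ⟦ does (falsifies? (lookup v) C) ⟧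

falsified-∷ : ∀ (x : Fin m) s C → falsified ((x , s) ∷ C) ≤ falsified C
falsified-∷ {m} x s C = ∑-mono (allVecs m) λ v →
  ⟦⟧-mono (falsifies? (lookup v) ((x , s) ∷ C)) (falsifies? (lookup v) C) All.tail

-- `flip x` does not affect `C`, and exactly one of `v` and `flip x v` falsifies the literal on `x`.
falsified-∷-∉ : ∀ (x : Fin m) s C → x ∉ vars C → falsified ((x , s) ∷ C) + falsified ((x , s) ∷ C) ≡ falsified C
falsified-∷-∉ {m} x s C x∉ = begin
  ∑ (allVecs m) f + ∑ (allVecs m) f            ≡⟨ cong (∑ (allVecs m) f +_) (∑-flip x f) ⟩
  ∑ (allVecs m) f + ∑ (allVecs m) (f ∘ flip x) ≡⟨ ∑-+ (allVecs m) f (f ∘ flip x) ⟨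
  ∑ (allVecs m) (λ v → f v + f (flip x v))     ≡⟨ ∑-cong (allVecs m) split ⟩
  falsified C                                  ∎
  where
  open ≡-Reasoning
  f : Vec Bool m → ℕ
  f v = ⟦ does (falsifies? (lookup v) ((x , s) ∷ C)) ⟧
  cases : ∀ b s F → ⟦ not (does (b Bool.≟ s)) ∧ F ⟧ + ⟦ not (does (not b Bool.≟ s)) ∧ F ⟧ ≡ ⟦ F ⟧
  cases true  true  F = refl
  cases true  false F = ℕ.+-identityʳ _
  cases false true  F = ℕ.+-identityʳ _
  cases false false F = refl
  split : ∀ v → f v + f (flip x v) ≡ ⟦ does (falsifies? (lookup v) C) ⟧
  split v rewrite lookup-flip x v | falsifies-flip v C x∉ = cases (lookup v x) s _

width-∷-∈ : ∀ {x : Fin m} {s} C → x ∈ vars C → width ((x , s) ∷ C) ≤ width C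
width-∷-∈ {m} {x} {s} C x∈ = ∑-mono (allFin m) λ e →
  ⟦⟧-mono (e ∈? vars ((x , s) ∷ C)) (e ∈? vars C) λ where
    (here refl) → x∈
    (there e∈)  → e∈

width-∷ : ∀ (x : Fin m) s C → width ((x , s) ∷ C) ≤ suc (width C)
width-∷ {m} x s C = begin
  width ((x , s) ∷ C)
    ≤⟨ ∑-mono (allFin m) pointwise ⟩
  ∑ (allFin m) (λ e → ⟦ does (x Fin.≟ e) ⟧ + ⟦ does (e ∈? vars C) ⟧)
    ≡⟨ ∑-+ (allFin m) (λ e → ⟦ does (x Fin.≟ e) ⟧) _ ⟩
  ∑ (allFin m) (λ e → ⟦ does (x Fin.≟ e) ⟧) + width C
    ≡⟨ cong (_+ width C) (∑-≟ x) ⟩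
  suc (width C)
    ∎
  where
  open ℕ.≤-Reasoning
  pointwise : ∀ e → ⟦ does (e ∈? vars ((x , s) ∷ C)) ⟧ ≤ ⟦ does (x Fin.≟ e) ⟧ + ⟦ does (e ∈? vars C) ⟧
  pointwise e with x Fin.≟ e
  ... | yes _  = ℕ.≤-trans (⟦⟧≤1 _) (s≤s z≤n)
  ... | no x≢e = ⟦⟧-mono (e ∈? vars ((x , s) ∷ C)) (e ∈? vars C) λ where
    (here e≡x) → contradiction (sym e≡x) x≢e
    (there e∈) → e∈

-- Each new variable halves the number of falsifying assignments; a repeated one does not raise the
-- width.
falsified-width : ∀ (C : Clause m) → falsified C * 2 ^ width C ≤ 2 ^ m
falsified-width {m} [] = begin
  falsified {m} [] * 2 ^ width {m} [] ≡⟨ cong₂ (λ a b → a * 2 ^ b) (∑-allVecs-const m 1) (trans (∑-const (allFin m) 0) (ℕ.*-zeroʳ (length (allFin m)))) ⟩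
  2 ^ m * 1 * 1                       ≡⟨ trans (ℕ.*-identityʳ _) (ℕ.*-identityʳ _) ⟩
  2 ^ m                               ∎
  where open ℕ.≤-Reasoning
falsified-width {m} ((x , s) ∷ C) with x ∈? vars C
... | yes x∈ = begin
  falsified ((x , s) ∷ C) * 2 ^ width ((x , s) ∷ C) ≤⟨ ℕ.*-mono-≤ (falsified-∷ x s C) (ℕ.^-monoʳ-≤ 2 (width-∷-∈ {s = s} C x∈)) ⟩
  falsified C * 2 ^ width C                         ≤⟨ falsified-width C ⟩
  2 ^ m                                             ∎
  where open ℕ.≤-Reasoning
... | no x∉ = begin
  F * 2 ^ width ((x , s) ∷ C) ≤⟨ ℕ.*-monoʳ-≤ F (ℕ.^-monoʳ-≤ 2 (width-∷ x s C)) ⟩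
  F * (2 * 2 ^ width C)       ≡⟨ solve 2 (λ f p → f :* (con 2 :* p) := (f :+ f) :* p) refl F (2 ^ width C) ⟩
  (F + F) * 2 ^ width C       ≡⟨ cong (_* 2 ^ width C) (falsified-∷-∉ x s C x∉) ⟩
  falsified C * 2 ^ width C   ≤⟨ falsified-width C ⟩
  2 ^ m                       ∎
  where
  open ℕ.≤-Reasoning
  F = falsified ((x , s) ∷ C)

-- Assignments counted by their set of violated vertices

module Counting {n : ℕ} (G : Graph n) where
  open Graph G

  -- Every vertex has charge 1, so it is violated when its incident edges have even sum.
  violated : Vec Bool #E → Vec Bool n
  violated v = tabulate λ u → not (parity (restrict v (incidentEdges G u)))

  -- Of the clauses forbidding a local assignment at a vertex, `v` falsifies just the one forbidding
  -- its own restriction, which belongs to the formula when that restriction has the wrong parity.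
  viol-Tseitin : ∀ v → viol (Tseitin G (λ _ → true)) (lookup v) ≡ count (violated v)
  viol-Tseitin v = begin
    viol (Tseitin G (λ _ → true)) (lookup v)
      ≡⟨ viol-∑ (Tseitin G (λ _ → true)) (lookup v) ⟩
    ∑ (Tseitin G (λ _ → true)) F
      ≡⟨ ∑-concatMap (vertexClauses G (λ _ → true)) (allFin n) F ⟩
    ∑ (allFin n) (λ u → ∑ (vertexClauses G (λ _ → true) u) F)
      ≡⟨ ∑-cong (allFin n) atVertex ⟩
    ∑ (allFin n) (λ u → ⟦ not (parity (restrict v (incidentEdges G u))) ⟧)
      ≡⟨ count-tabulate n _ ⟨
    count (violated v)
      ∎
    where
    open ≡-Reasoning
    F : Clause #E → ℕ
    F C = ⟦ does (falsifies? (lookup v) C) ⟧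
    odd? : Decidable λ ρ → ¬ (parity {#E} ρ ≡ true)
    odd? ρ = ¬? (parity ρ Bool.≟ true)
    does-odd : ∀ p → not (does (p Bool.≟ true)) ≡ not p
    does-odd true  = refl
    does-odd false = refl
    atVertex : ∀ u → ∑ (vertexClauses G (λ _ → true) u) F ≡ ⟦ not (parity (restrict v (incidentEdges G u))) ⟧
    atVertex u = begin
      ∑ (map forbid (filter odd? (localAssignments es))) F              ≡⟨ ∑-map forbid (filter odd? (localAssignments es)) F ⟩
      ∑ (filter odd? (localAssignments es)) (F ∘ forbid)                ≡⟨ ∑-filter odd? (localAssignments es) (F ∘ forbid) ⟩
      ∑ (localAssignments es) (λ ρ → ⟦ does (odd? ρ) ⟧ * F (forbid ρ))  ≡⟨ ∑-forbid v es (λ ρ → ⟦ does (odd? ρ) ⟧) ⟩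
      ⟦ does (odd? (restrict v es)) ⟧                                   ≡⟨ cong ⟦_⟧ (does-odd (parity (restrict v es))) ⟩
      ⟦ not (parity (restrict v es)) ⟧                                  ∎
      where es = incidentEdges G u

  -- The two ends of `e` are distinct and no other vertex is incident with it, so exactly two
  -- parities change.
  violated-flip : ∀ e v → violated (flip e v) ≡ flip (proj₁ (ends e)) (flip (proj₂ (ends e)) (violated v))
  violated-flip e v = trans (Vec.tabulate-cong pointwise) (Vec.tabulate∘lookup _)
    where
    p = proj₁ (ends e)
    q = proj₂ (ends e)
    p≢q : p ≢ q
    p≢q = Fin.<⇒≢ (ordered e)
    unique : ∀ u → Unique (incidentEdges G u)
    unique u = filter⁺ (incident? G u) (allFin⁺ #E)
    at : Vec Bool #E → Fin n → Bool
    at v u = parity (restrict v (incidentEdges G u))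
    incident : ∀ {u} → Incident G u e → at (flip e v) u ≡ not (at v u)
    incident {u} i = parity-flip-∈ v (incidentEdges G u) (unique u) (∈-filter⁺ (incident? G u) (∈-allFin e) i)
    pointwise : ∀ u → not (at (flip e v) u) ≡ lookup (flip p (flip q (violated v))) u
    pointwise u with u Fin.≟ p | u Fin.≟ q
    ... | yes refl | _ = sym (begin
      lookup (flip p (flip q (violated v))) p ≡⟨ lookup-flip p (flip q (violated v)) ⟩
      not (lookup (flip q (violated v)) p)    ≡⟨ cong not (lookup-flip-≢ p≢q (violated v)) ⟩
      not (lookup (violated v) p)             ≡⟨ cong not (Vec.lookup∘tabulate _ p) ⟩
      not (not (at v p))                      ≡⟨ cong not (incident (inj₁ refl)) ⟨
      not (at (flip e v) p)                   ∎)
      where open ≡-Reasoning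
    ... | no u≢p | yes refl = sym (begin
      lookup (flip p (flip q (violated v))) q ≡⟨ lookup-flip-≢ u≢p (flip q (violated v)) ⟩
      lookup (flip q (violated v)) q          ≡⟨ lookup-flip q (violated v) ⟩
      not (lookup (violated v) q)             ≡⟨ cong not (Vec.lookup∘tabulate _ q) ⟩
      not (not (at v q))                      ≡⟨ cong not (incident (inj₂ refl)) ⟨
      not (at (flip e v) q)                   ∎)
      where open ≡-Reasoning
    ... | no u≢p | no u≢q = sym (begin
      lookup (flip p (flip q (violated v))) u ≡⟨ lookup-flip-≢ u≢p (flip q (violated v)) ⟩
      lookup (flip q (violated v)) u          ≡⟨ lookup-flip-≢ u≢q (violated v) ⟩
      lookup (violated v) u                   ≡⟨ Vec.lookup∘tabulate _ u ⟩
      not (at v u)                            ≡⟨ cong (not ∘ parity) (restrict-flip-∉ v (incidentEdges G u) e∉) ⟨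
      not (at (flip e v) u)                   ∎)
      where
      open ≡-Reasoning
      e∉ : e ∉ incidentEdges G u
      e∉ e∈ with proj₂ (∈-filter⁻ (incident? G u) {xs = allFin #E} e∈)
      ... | inj₁ u≡p = u≢p u≡p
      ... | inj₂ u≡q = u≢q u≡q

  -- A product of indicators, so that sums can be interchanged. Every assignment falsifies the empty
  -- clause, hence `N [] U` counts all assignments with violated set `U`.
  N : Clause #E → Vec Bool n → ℕ
  N C U = ∑[ v ∈ allVecs #E ] (⟦ does (violated v ≟ⱽ U) ⟧ * ⟦ does (falsifies? (lookup v) C) ⟧)

  -- Flipping `e` is an involution on assignments that keeps the status of `C` and toggles both ends
  -- of `e` in the violated set.
  N-flip : ∀ C e U → e ∉ vars C → N C U ≡ N C (flip (proj₁ (ends e)) (flip (proj₂ (ends e)) U))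
  N-flip C e U e∉ = trans (∑-flip e _) (∑-cong (allVecs #E) λ v →
    cong₂ (λ a b → ⟦ a ⟧ * ⟦ b ⟧)
      (does-⇔ (mk⇔ (to v) (from v)) (violated (flip e v) ≟ⱽ U) (violated v ≟ⱽ flip p (flip q U)))
      (falsifies-flip v C e∉))
    where
    p = proj₁ (ends e)
    q = proj₂ (ends e)
    involutive : ∀ W → flip p (flip q (flip p (flip q W))) ≡ W
    involutive W = begin
      flip p (flip q (flip p (flip q W))) ≡⟨ cong (flip p) (flip-comm q p (flip q W)) ⟩
      flip p (flip p (flip q (flip q W))) ≡⟨ flip-involutive p _ ⟩
      flip q (flip q W)                   ≡⟨ flip-involutive q W ⟩
      W                                   ∎
      where open ≡-Reasoning
    to : ∀ v → violated (flip e v) ≡ U → violated v ≡ flip p (flip q U)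
    to v refl = trans (sym (involutive (violated v))) (cong (λ W → flip p (flip q W)) (sym (violated-flip e v)))
    from : ∀ v → violated v ≡ flip p (flip q U) → violated (flip e v) ≡ U
    from v eq = trans (violated-flip e v) (trans (cong (λ W → flip p (flip q W)) eq) (involutive U))

  N-width : ∀ C U → N C U * 2 ^ width C ≤ 2 ^ #E
  N-width C U = ℕ.≤-trans (ℕ.*-monoˡ-≤ (2 ^ width C) (∑-mono (allVecs #E) λ v → indicator≤ (does (violated v ≟ⱽ U)) _))
                          (falsified-width C)
    where
    indicator≤ : ∀ b k → ⟦ b ⟧ * k ≤ k
    indicator≤ true  k = ℕ.≤-reflexive (ℕ.+-identityʳ k)
    indicator≤ false k = z≤n

  module _ (R : SubCubeSumsRefutation (Tseitin G (λ _ → true))) where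
    open SubCubeSumsRefutation R

    -- Sum the identity of the refutation over the assignments with violated set `U`, where the
    -- Tseitin side is constantly `count U`. The summand `N [] U` comes from the 1 in the identity.
    ∑-N : ∀ U → ∑ clauses (λ C → N C U) + N [] U ≡ count U * N [] U
    ∑-N U = begin
      ∑ clauses (λ C → N C U) + N [] U
        ≡⟨ cong (_+ N [] U) (∑-swap clauses (allVecs #E) (λ C v → e v * F v C)) ⟩
      ∑ (allVecs #E) (λ v → ∑ clauses (λ C → e v * F v C)) + N [] U
        ≡⟨ ∑-+ (allVecs #E) _ _ ⟨
      ∑ (allVecs #E) (λ v → ∑ clauses (λ C → e v * F v C) + e v * 1)
        ≡⟨ ∑-cong (allVecs #E) pointwise ⟩
      ∑ (allVecs #E) (λ v → count U * (e v * 1))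
        ≡⟨ ∑-*ˡ (allVecs #E) (count U) _ ⟩
      count U * N [] U
        ∎
      where
      open ≡-Reasoning
      e : Vec Bool #E → ℕ
      e v = ⟦ does (violated v ≟ⱽ U) ⟧
      F : Vec Bool #E → Clause #E → ℕ
      F v C = ⟦ does (falsifies? (lookup v) C) ⟧
      onFibre : ∀ v (d : Dec (violated v ≡ U)) →
                ⟦ does d ⟧ * ∑ clauses (F v) + ⟦ does d ⟧ * 1 ≡ count U * (⟦ does d ⟧ * 1)
      onFibre v (no _)     = sym (ℕ.*-zeroʳ (count U))
      onFibre v (yes refl) = begin
        1 * ∑ clauses (F v) + 1                          ≡⟨ cong (_+ 1) (ℕ.*-identityˡ _) ⟩
        ∑ clauses (F v) + 1                              ≡⟨ cong (_+ 1) (viol-∑ clauses (lookup v)) ⟨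
        viol clauses (lookup v) + 1                      ≡⟨ ℕ.+-comm _ 1 ⟩
        1 + viol clauses (lookup v)                      ≡⟨ identity (lookup v) ⟨
        viol (Tseitin G (λ _ → true)) (lookup v)         ≡⟨ viol-Tseitin v ⟩
        count (violated v)                               ≡⟨ ℕ.*-identityʳ _ ⟨
        count (violated v) * 1                           ∎
      pointwise : ∀ v → ∑ clauses (λ C → e v * F v C) + e v * 1 ≡ count U * (e v * 1)
      pointwise v = trans (cong (_+ e v * 1) (∑-*ˡ clauses (e v) (F v))) (onFibre v (violated v ≟ⱽ U))

-- Components of the graph without the edges of a clause

module Linking {n : ℕ} (G : Graph n) where
  open Graph G
  open Counting G

  -- Stands in for connectivity by edges outside `C`: it records the effect of a path on the counts,
  -- so that no paths have to be formed.
  Linked : Clause #E → Fin n → Fin n → Set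
  Linked C u v = ∀ U → N C (flip u U) ≡ N C (flip v U)

  linked-ends : ∀ C e → e ∉ vars C → Linked C (proj₁ (ends e)) (proj₂ (ends e))
  linked-ends C e e∉ U = begin
    N C (flip p U)                   ≡⟨ N-flip C e (flip p U) e∉ ⟩
    N C (flip p (flip q (flip p U))) ≡⟨ cong (N C) (flip-comm p q (flip p U)) ⟩
    N C (flip q (flip p (flip p U))) ≡⟨ cong (N C ∘ flip q) (flip-involutive p U) ⟩
    N C (flip q U)                   ∎
    where
    open ≡-Reasoning
    p = proj₁ (ends e)
    q = proj₂ (ends e)

  -- Linkage trades `u` for a second `v`, and the two toggles of `v` cancel.
  linked-pair : ∀ {C u v} → Linked C u v → ∀ U → N C (flip u (flip v U)) ≡ N C U
  linked-pair {C} {u} {v} u~v U = trans (u~v (flip v U)) (cong (N C) (flip-involutive v U))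

  -- Component names for the edges of `es` outside `C`, in the manner of union-find.
  record Labelling (C : Clause #E) (es : List (Fin #E)) : Set where
    field
      label    : Fin n → Fin n
      sound    : ∀ u v → label u ≡ label v → Linked C u v
      complete : ∀ {e} → e ∈ es → e ∉ vars C → label (proj₁ (ends e)) ≡ label (proj₂ (ends e))

  -- Edges are processed one at a time: an edge of `C` changes nothing, any other renames the label
  -- of its first end to that of its second.
  labelling : ∀ C es → Labelling C es
  labelling C [] = record { label = id ; sound = λ { u .u refl U → refl } ; complete = λ () }
  labelling C (e ∷ es) with labelling C es | e ∈? vars C
  ... | L | yes e∈ = record
    { label    = label
    ; sound    = sound
    ; complete = λ { (here refl) e∉ → contradiction e∈ e∉ ; (there i) → complete i }
    }
    where open Labelling L
  ... | L | no e∉ = record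
    { label    = merge ∘ label
    ; sound    = sound′
    ; complete = λ { (here refl) _ → trans merge-p (sym merge-q) ; (there i) j → cong merge (complete i j) }
    }
    where
    open Labelling L
    p = proj₁ (ends e)
    q = proj₂ (ends e)
    merge : Fin n → Fin n
    merge x with x Fin.≟ label p
    ... | yes _ = label q
    ... | no  _ = x
    merge-p : merge (label p) ≡ label q
    merge-p with label p Fin.≟ label p
    ... | yes _ = refl
    ... | no ¬r = contradiction refl ¬r
    merge-q : merge (label q) ≡ label q
    merge-q with label q Fin.≟ label p
    ... | yes _ = refl
    ... | no  _ = refl
    p~q : Linked C p q
    p~q = linked-ends C e e∉
    sound′ : ∀ u v → merge (label u) ≡ merge (label v) → Linked C u v
    sound′ u v eq U with label u Fin.≟ label p | label v Fin.≟ label p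
    ... | yes u~p | yes v~p = sound u v (trans u~p (sym v~p)) U
    -- Here `u` and `v` come from the two sides of the merge, and the link crosses the edge `e` from
    -- `p` to `q`.
    ... | yes u~p | no _    = trans (sound u p u~p U) (trans (p~q U) (sound q v eq U))
    ... | no _    | yes v~p = trans (sound u q eq U) (trans (sym (p~q U)) (sound p v (sym v~p) U))
    ... | no _    | no _    = sound u v eq U

∣∣≡count : ∀ (X : Subset n) → ∣ X ∣ ≡ count X
∣∣≡count []          = refl
∣∣≡count (true ∷ X)  = cong suc (∣∣≡count X)
∣∣≡count (false ∷ X) = ∣∣≡count X

size : (Fin n → Bool) → ℕ
size {n} X = ∑[ u ∈ allFin n ] ⟦ X u ⟧

length-allFin : ∀ n → length (allFin n) ≡ n
length-allFin n = length-tabulate id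

size-not : ∀ (X : Fin n → Bool) → size X + size (not ∘ X) ≡ n
size-not {n} X = begin
  size X + size (not ∘ X)                         ≡⟨ ∑-+ (allFin n) _ _ ⟨
  ∑ (allFin n) (λ u → ⟦ X u ⟧ + ⟦ not (X u) ⟧)    ≡⟨ ∑-cong (allFin n) (λ u → complement (X u)) ⟩
  ∑ (allFin n) (λ _ → 1)                          ≡⟨ ∑-const (allFin n) 1 ⟩
  length (allFin n) * 1                           ≡⟨ trans (ℕ.*-identityʳ _) (length-allFin n) ⟩
  n                                               ∎
  where
  open ≡-Reasoning
  complement : ∀ b → ⟦ b ⟧ + ⟦ not b ⟧ ≡ 1
  complement true  = refl
  complement false = refl

<ᵇ-suc : ∀ i j → ⟦ i <ᵇ suc j ⟧ ≡ ⟦ i <ᵇ j ⟧ + ⟦ i ≡ᵇ j ⟧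
<ᵇ-suc zero    zero    = refl
<ᵇ-suc zero    (suc j) = refl
<ᵇ-suc (suc i) zero    = refl
<ᵇ-suc (suc i) (suc j) = <ᵇ-suc i j

-- The giant component left by a narrow clause

module Giant {n : ℕ} (G : Graph n)
             (expansion : ∀ X → 2 * ∣ X ∣ ≤ n → 10 * ∣ X ∣ ≤ length (δ G X)) where
  open Graph G
  open Linking G

  boundary-width : ∀ C X → (∀ e → Crosses G X e → e ∈ vars C) → length (δ G X) ≤ width C
  boundary-width C X closed = begin
    length (δ G X)                                    ≡⟨ length-filter (crosses? G X) (allFin #E) ⟩
    ∑ (allFin #E) (λ e → ⟦ does (crosses? G X e) ⟧)   ≤⟨ ∑-mono (allFin #E) (λ e → ⟦⟧-mono (crosses? G X e) (e ∈? vars C) (closed e)) ⟩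
    width C                                           ∎
    where open ℕ.≤-Reasoning

  -- No edge outside `C` leaves `X`, so the whole boundary of `X` consists of variables of `C`, and
  -- expansion applies.
  small-closed : ∀ C (X : Fin n → Bool) →
    (∀ e → e ∉ vars C → X (proj₁ (ends e)) ≡ X (proj₂ (ends e))) →
    2 * size X ≤ n → 10 * size X ≤ width C
  small-closed C X closed small = begin
    10 * size X              ≡⟨ cong (10 *_) size≡ ⟨
    10 * ∣ tabulate X ∣      ≤⟨ expansion (tabulate X) (subst (λ k → 2 * k ≤ n) (sym size≡) small) ⟩
    length (δ G (tabulate X)) ≤⟨ boundary-width C (tabulate X) crossing ⟩
    width C                  ∎
    where
    open ℕ.≤-Reasoning
    size≡ : ∣ tabulate X ∣ ≡ size X
    size≡ = trans (∣∣≡count (tabulate X)) (count-tabulate n X)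
    transfer : ∀ {u v} → X u ≡ X v → u Subset.∈ tabulate X → v Subset.∈ tabulate X
    transfer {u} {v} eq u∈ = Vec.lookup⇒[]= v (tabulate X) (trans (Vec.lookup∘tabulate X v)
      (trans (sym eq) (trans (sym (Vec.lookup∘tabulate X u)) (Vec.[]=⇒lookup u∈))))
    crossing : ∀ e → Crosses G (tabulate X) e → e ∈ vars C
    crossing e cr with e ∈? vars C | cr
    ... | yes e∈ | _               = e∈
    ... | no e∉  | inj₁ (p∈ , q∉) = contradiction (transfer (closed e e∉) p∈) q∉
    ... | no e∉  | inj₂ (q∈ , p∉) = contradiction (transfer (sym (closed e e∉)) q∈) p∉

  -- Both `X` and its complement are closed, and one of them has at most half of the vertices.
  dichotomy : ∀ C (X : Fin n → Bool) →
    (∀ e → e ∉ vars C → X (proj₁ (ends e)) ≡ X (proj₂ (ends e))) →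
    10 * size X ≤ width C ⊎ 10 * size (not ∘ X) ≤ width C
  dichotomy C X closed with ℕ.≤-total (2 * size X) n
  ... | inj₁ small = inj₁ (small-closed C X closed small)
  ... | inj₂ large = inj₂ (small-closed C (not ∘ X) (λ e e∉ → cong not (closed e e∉))
      (ℕ.+-cancelˡ-≤ n (2 * size (not ∘ X)) n (begin
        n + 2 * size (not ∘ X)            ≤⟨ ℕ.+-monoˡ-≤ _ large ⟩
        2 * size X + 2 * size (not ∘ X)   ≡⟨ ℕ.*-distribˡ-+ 2 (size X) _ ⟨
        2 * (size X + size (not ∘ X))     ≡⟨ cong (2 *_) (size-not X) ⟩
        2 * n                             ≡⟨ cong (n +_) (ℕ.+-identityʳ n) ⟩
        n + n                             ∎)))
    where open ℕ.≤-Reasoning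

  -- When `width C` is below 2n, `cosmall` leaves fewer than n/5 vertices outside.
  record GiantClass (C : Clause #E) : Set where
    field
      member    : Fin n → Bool
      cosmall  : 10 * size (not ∘ member) ≤ width C
      linked    : ∀ u v → member u ≡ true → member v ≡ true → Linked C u v

  -- Call a set small if it has at most `width C` / 10 vertices. Unite the label classes one by one.
  -- When the complement of the union first becomes small instead of the union, the class just added
  -- is not small, since three small sets cannot cover all vertices; so its complement is small.
  giantClass : ∀ C → width C < 2 * n → GiantClass C
  giantClass C narrow = [ id , ⊥-elim ∘ not-small ]′ (search n)
    where
    open Labelling (labelling C (allFin #E))

    below class : ℕ → Fin n → Bool
    below j u = toℕ (label u) <ᵇ j
    class j u = toℕ (label u) ≡ᵇ j

    closed : ∀ (f : Fin n → Bool) e → e ∉ vars C → f (label (proj₁ (ends e))) ≡ f (label (proj₂ (ends e)))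
    closed f e e∉ = cong f (complete (∈-allFin e) e∉)

    size-below : ∀ j → size (below (suc j)) ≡ size (below j) + size (class j)
    size-below j = trans (∑-cong (allFin n) λ u → <ᵇ-suc (toℕ (label u)) j) (∑-+ (allFin n) _ _)

    class-linked : ∀ j u v → class j u ≡ true → class j v ≡ true → Linked C u v
    class-linked j u v u∈ v∈ = sound u v (Fin.toℕ-injective (trans (≡ᵇ-true u∈) (sym (≡ᵇ-true v∈))))
      where
      ≡ᵇ-true : ∀ {i} → (i ≡ᵇ j) ≡ true → i ≡ j
      ≡ᵇ-true {i} eq = ℕ.≡ᵇ⇒≡ i j (subst T (sym eq) _)

    -- Three small sets together have fewer than 6n/10 vertices.
    too-many : ∀ a b c → a + b + c ≡ n → 10 * a ≤ width C → 10 * b ≤ width C → 10 * c ≤ width C → ⊥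
    too-many a b c total ha hb hc = ℕ.<-irrefl refl (begin-strict
      10 * n                       ≡⟨ cong (10 *_) total ⟨
      10 * (a + b + c)             ≡⟨ solve 3 (λ a b c → con 10 :* (a :+ b :+ c) := con 10 :* a :+ con 10 :* b :+ con 10 :* c) refl a b c ⟩
      10 * a + 10 * b + 10 * c     ≤⟨ ℕ.+-mono-≤ (ℕ.+-mono-≤ ha hb) hc ⟩
      width C + width C + width C  <⟨ ℕ.+-mono-< (ℕ.+-mono-< narrow narrow) narrow ⟩
      2 * n + 2 * n + 2 * n        ≡⟨ solve 1 (λ n → con 2 :* n :+ con 2 :* n :+ con 2 :* n := con 6 :* n) refl n ⟩
      6 * n                        ≤⟨ ℕ.*-monoˡ-≤ n (ℕ.m≤m+n 6 4) ⟩
      10 * n                       ∎)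
      where
      open ℕ.≤-Reasoning

    search : ∀ j → GiantClass C ⊎ 10 * size (below j) ≤ width C
    search zero    = inj₂ (subst (λ k → 10 * k ≤ width C)
      (sym (trans (∑-const (allFin n) 0) (ℕ.*-zeroʳ (length (allFin n))))) z≤n)
    search (suc j) with search j
    ... | inj₁ giant = inj₁ giant
    ... | inj₂ small with dichotomy C (below (suc j)) (closed (λ x → toℕ x <ᵇ suc j))
    ...   | inj₁ small′ = inj₂ small′
    ...   | inj₂ large with dichotomy C (class j) (closed (λ x → toℕ x ≡ᵇ j))
    ...     | inj₂ giant  = inj₁ record { member = class j ; cosmall = giant ; linked = class-linked j }
    ...     | inj₁ small″ = ⊥-elim (too-many (size (below j)) (size (class j)) (size (not ∘ below (suc j))) total small small″ large)
      where
      total : size (below j) + size (class j) + size (not ∘ below (suc j)) ≡ n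
      total = trans (cong (_+ size (not ∘ below (suc j))) (sym (size-below j))) (size-not (below (suc j)))

    -- All labels lie below n, so the final union is the whole vertex set.
    not-small : ¬ (10 * size (below n) ≤ width C)
    not-small small = ℕ.<-irrefl refl (begin-strict
      10 * n              ≡⟨ cong (10 *_) size≡n ⟨
      10 * size (below n) ≤⟨ small ⟩
      width C             <⟨ narrow ⟩
      2 * n               ≤⟨ ℕ.*-monoˡ-≤ n (ℕ.m≤m+n 2 8) ⟩
      10 * n              ∎)
      where
      open ℕ.≤-Reasoning
      size≡n : size (below n) ≡ n
      size≡n = trans (∑-cong (allFin n) λ u → cong ⟦_⟧ (dec-true (toℕ (label u) ℕ.<? n) (Fin.toℕ<n (label u))))
        (trans (∑-const (allFin n) 1) (trans (ℕ.*-identityʳ _) (length-allFin n)))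

-- Triples against 5-tuples

-- Repeated entries are allowed, so that sums factor over the coordinates; `coincidences` later
-- accounts for the repetitions.
tuples : ∀ n k → List (Vec (Fin n) k)
tuples n zero    = [ [] ]
tuples n (suc k) = concatMap (λ a → map (a ∷_) (tuples n k)) (allFin n)

∑-tuples-suc : ∀ n k f → ∑ (tuples n (suc k)) f ≡ ∑[ a ∈ allFin n ] ∑[ t ∈ tuples n k ] f (a ∷ t)
∑-tuples-suc n k f = trans (∑-concatMap _ (allFin n) f)
  (∑-cong (allFin n) λ a → ∑-map (a ∷_) (tuples n k) f)

∑-tuples-const : ∀ n k c → ∑[ t ∈ tuples n k ] c ≡ n ^ k * c
∑-tuples-const n zero    c = refl
∑-tuples-const n (suc k) c = begin
  ∑ (tuples n (suc k)) (λ _ → c)                     ≡⟨ ∑-tuples-suc n k (λ _ → c) ⟩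
  ∑ (allFin n) (λ _ → ∑ (tuples n k) (λ _ → c))      ≡⟨ ∑-const (allFin n) _ ⟩
  length (allFin n) * ∑ (tuples n k) (λ _ → c)       ≡⟨ cong₂ _*_ (length-allFin n) (∑-tuples-const n k c) ⟩
  n * (n ^ k * c)                                    ≡⟨ ℕ.*-assoc n _ c ⟨
  n ^ suc k * c                                      ∎
  where open ≡-Reasoning

rotate : Vec A (suc m) → Vec A (suc m)
rotate (a ∷ t) = t ∷ʳ a

-- Rotate the tail by induction, then exchange the two outermost sums.
∑-rotate : ∀ n k f → ∑ (tuples n (suc k)) f ≡ ∑ (tuples n (suc k)) (f ∘ rotate)
∑-rotate n zero    f = trans (∑-tuples-suc n 0 f) (sym (∑-tuples-suc n 0 (f ∘ rotate)))
∑-rotate n (suc k) f = begin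
  ∑ (tuples n (2 + k)) f
    ≡⟨ ∑-tuples-suc n (suc k) f ⟩
  (∑[ b ∈ allFin n ] ∑[ t ∈ tuples n (suc k) ] f (b ∷ t))
    ≡⟨ ∑-cong (allFin n) (λ b → trans (∑-rotate n k (f ∘ (b ∷_))) (∑-tuples-suc n k _)) ⟩
  (∑[ b ∈ allFin n ] ∑[ a ∈ allFin n ] ∑[ t ∈ tuples n k ] f (b ∷ (t ∷ʳ a)))
    ≡⟨ ∑-swap (allFin n) (allFin n) _ ⟩
  (∑[ a ∈ allFin n ] ∑[ b ∈ allFin n ] ∑[ t ∈ tuples n k ] f (b ∷ (t ∷ʳ a)))
    ≡⟨ ∑-cong (allFin n) (λ a → ∑-tuples-suc n k (λ t → f (t ∷ʳ a))) ⟨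
  (∑[ a ∈ allFin n ] ∑[ t ∈ tuples n (suc k) ] f (t ∷ʳ a))
    ≡⟨ ∑-tuples-suc n (suc k) (f ∘ rotate) ⟨
  ∑ (tuples n (2 + k)) (f ∘ rotate)
    ∎
  where open ≡-Reasoning

ind-↭ : ∀ {xs ys : List (Fin n)} → xs ↭ ys → ind xs ≡ ind ys
ind-↭ Perm.refl                = refl
ind-↭ (prep x p)               = cong (flip x) (ind-↭ p)
ind-↭ (swap {xs = xs} x y p)   = trans (flip-comm x y (ind xs)) (cong (flip y ∘ flip x) (ind-↭ p))
ind-↭ (Perm.trans p q)         = trans (ind-↭ p) (ind-↭ q)

AllTrue : (x y z w : Bool) → Set
AllTrue x y z w = x ≡ true × y ≡ true × z ≡ true × w ≡ true

-- The second elementary symmetric polynomial, grouped by rotation: neighbouring positions, then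
-- positions two apart. The order matches `orbit adjacent` and `orbit skip` term by term.
pairs : Vec ℕ 5 → ℕ
pairs (x ∷ y ∷ z ∷ w ∷ v ∷ []) =
  (x * y + y * z + z * w + w * v + v * x) + (x * z + y * w + z * v + w * x + v * y)

∀-Bool? : ∀ {P : Bool → Set} → Decidable P → Dec (∀ b → P b)
∀-Bool? P? = map′ (λ { (f , t) false → f ; (f , t) true → t }) (λ h → h false , h true)
                  (P? false ×-dec P? true)

-- Three true entries make only three pairs. If at most one entry is false, the other four are
-- cyclically consecutive. The 32 cases are decided by computation.
pairs≤3⊎four : ∀ x y z w v →
  pairs (⟦ x ⟧ ∷ ⟦ y ⟧ ∷ ⟦ z ⟧ ∷ ⟦ w ⟧ ∷ ⟦ v ⟧ ∷ []) ≤ 3 ⊎ AllTrue x y z w ⊎ AllTrue y z w v ⊎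
  AllTrue z w v x ⊎ AllTrue w v x y ⊎ AllTrue v x y z
pairs≤3⊎four = from-yes (∀-Bool? λ x → ∀-Bool? λ y → ∀-Bool? λ z → ∀-Bool? λ w → ∀-Bool? λ v →
  (pairs (⟦ x ⟧ ∷ ⟦ y ⟧ ∷ ⟦ z ⟧ ∷ ⟦ w ⟧ ∷ ⟦ v ⟧ ∷ []) ℕ.≤? 3) ⊎-dec allTrue? x y z w ⊎-dec allTrue? y z w v ⊎-dec
  allTrue? z w v x ⊎-dec allTrue? w v x y ⊎-dec allTrue? v x y z)
  where
  allTrue? : ∀ x y z w → Dec (AllTrue x y z w)
  allTrue? x y z w = (x Bool.≟ true) ×-dec (y Bool.≟ true) ×-dec (z Bool.≟ true) ×-dec (w Bool.≟ true)

-- Applied with `f xs = N C (ind xs)` and `X` the giant class of a narrow clause `C` of the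
-- refutation.
module PairDeletion {n : ℕ} (f : List (Fin n) → ℕ) (X : Fin n → Bool)
  (f-↭ : ∀ {xs ys} → xs ↭ ys → f xs ≡ f ys)
  (f-delete : ∀ {a b} xs → X a ≡ true → X b ≡ true → f (a ∷ b ∷ xs) ≡ f xs)
  (f-single : ∀ a → f (a ∷ []) ≡ 0)
  where

  total : ℕ → ℕ
  total k = ∑[ t ∈ tuples n k ] f (toList t)

  Weight : Set
  Weight = Vec (Fin n) 5 → ℕ

  weighted : Weight → ℕ
  weighted w = ∑[ t ∈ tuples n 5 ] (f (toList t) * w t)

  weighted-rotate : ∀ w → weighted w ≡ weighted (w ∘ rotate)
  weighted-rotate w = trans (∑-rotate n 4 _) (∑-cong (tuples n 5) λ where
    t@(a ∷ b ∷ c ∷ d ∷ e ∷ []) → cong (_* w (rotate t)) (sym (f-↭ (∷↭∷ʳ a (b ∷ c ∷ d ∷ e ∷ [])))))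

  weighted-+ : ∀ w w′ → weighted (λ t → w t + w′ t) ≡ weighted w + weighted w′
  weighted-+ w w′ = trans (∑-cong (tuples n 5) λ t → ℕ.*-distribˡ-+ (f (toList t)) (w t) (w′ t))
                          (∑-+ (tuples n 5) _ _)

  orbit : Weight → Weight
  orbit w t = w t + w (rotate t) + w (rotate (rotate t)) + w (rotate (rotate (rotate t)))
                  + w (rotate (rotate (rotate (rotate t))))

  -- As `f` is symmetric, each of the five rotations of `w` has the same weighted sum.
  weighted-orbit : ∀ w → weighted (orbit w) ≡ 5 * weighted w
  weighted-orbit w = begin
    weighted (orbit w)                 ≡⟨ weighted-+ _ w₄ ⟩
    weighted _ + W₄                    ≡⟨ cong (_+ W₄) (weighted-+ _ w₃) ⟩
    weighted _ + W₃ + W₄               ≡⟨ cong (λ s → s + W₃ + W₄) (weighted-+ _ w₂) ⟩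
    weighted _ + W₂ + W₃ + W₄          ≡⟨ cong (λ s → s + W₂ + W₃ + W₄) (weighted-+ w w₁) ⟩
    weighted w + W₁ + W₂ + W₃ + W₄     ≡⟨ cong (λ s → weighted w + W₁ + W₂ + W₃ + s) eq₄ ⟨
    weighted w + W₁ + W₂ + W₃ + weighted w ≡⟨ cong (λ s → weighted w + W₁ + W₂ + s + weighted w) eq₃ ⟨
    weighted w + W₁ + W₂ + weighted w + weighted w ≡⟨ cong (λ s → weighted w + W₁ + s + weighted w + weighted w) eq₂ ⟨
    weighted w + W₁ + weighted w + weighted w + weighted w ≡⟨ cong (λ s → weighted w + s + weighted w + weighted w + weighted w) eq₁ ⟨
    weighted w + weighted w + weighted w + weighted w + weighted w ≡⟨ solve 1 (λ s → s :+ s :+ s :+ s :+ s := con 5 :* s) refl (weighted w) ⟩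
    5 * weighted w                     ∎
    where
    open ≡-Reasoning
    w₁ = w ∘ rotate
    w₂ = w₁ ∘ rotate
    w₃ = w₂ ∘ rotate
    w₄ = w₃ ∘ rotate
    W₁ = weighted w₁
    W₂ = weighted w₂
    W₃ = weighted w₃
    W₄ = weighted w₄
    eq₁ = weighted-rotate w
    eq₂ = trans eq₁ (weighted-rotate w₁)
    eq₃ = trans eq₂ (weighted-rotate w₂)
    eq₄ = trans eq₃ (weighted-rotate w₃)

  φ : Fin n → ℕ
  φ a = ⟦ X a ⟧

  -- Representatives of the two rotation orbits of the ten pairs of positions.
  adjacent skip : Weight
  adjacent (a ∷ b ∷ _)     = φ a * φ b
  skip     (a ∷ _ ∷ c ∷ _) = φ a * φ c

  -- Exchanging the second and third entries turns one weight into the other and leaves `f`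
  -- unchanged.
  weighted-skip : weighted skip ≡ weighted adjacent
  weighted-skip = begin
    weighted skip
      ≡⟨ unfold _ ⟩
    (∑[ a ∈ V ] ∑[ b ∈ V ] ∑[ c ∈ V ] ∑[ t ∈ tuples n 2 ] (f (toList (a ∷ b ∷ c ∷ t)) * (φ a * φ c)))
      ≡⟨ ∑-cong V (λ a → ∑-swap V V _) ⟩
    (∑[ a ∈ V ] ∑[ c ∈ V ] ∑[ b ∈ V ] ∑[ t ∈ tuples n 2 ] (f (toList (a ∷ b ∷ c ∷ t)) * (φ a * φ c)))
      ≡⟨ ∑-cong V (λ a → ∑-cong V λ c → ∑-cong V λ b → ∑-cong (tuples n 2) λ t →
           cong (_* (φ a * φ c)) (f-↭ (prep a (swap b c Perm.refl)))) ⟩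
    (∑[ a ∈ V ] ∑[ c ∈ V ] ∑[ b ∈ V ] ∑[ t ∈ tuples n 2 ] (f (toList (a ∷ c ∷ b ∷ t)) * (φ a * φ c)))
      ≡⟨ unfold _ ⟨
    weighted adjacent
      ∎
    where
    open ≡-Reasoning
    V = allFin n
    unfold : ∀ g → ∑ (tuples n 5) g ≡ ∑[ a ∈ V ] ∑[ b ∈ V ] ∑[ c ∈ V ] ∑[ t ∈ tuples n 2 ] g (a ∷ b ∷ c ∷ t)
    unfold g = trans (∑-tuples-suc n 4 g) (∑-cong V λ a →
      trans (∑-tuples-suc n 3 _) (∑-cong V λ b → ∑-tuples-suc n 2 _))

  -- The weight vanishes unless both leading entries lie in `X`; then they can be deleted, and the
  -- sum factors into triples and two free choices from `X`.
  weighted-adjacent : weighted adjacent ≡ total 3 * (size X * size X)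
  weighted-adjacent = begin
    weighted adjacent
      ≡⟨ trans (∑-tuples-suc n 4 _) (∑-cong V λ a → ∑-tuples-suc n 3 _) ⟩
    (∑[ a ∈ V ] ∑[ b ∈ V ] ∑[ t ∈ tuples n 3 ] (f (a ∷ b ∷ toList t) * (φ a * φ b)))
      ≡⟨ ∑-cong V (λ a → ∑-cong V λ b → trans (∑-cong (tuples n 3) λ t → delete a b (toList t)) (∑-*ʳ (tuples n 3) (φ a * φ b) _)) ⟩
    (∑[ a ∈ V ] ∑[ b ∈ V ] total 3 * (φ a * φ b))
      ≡⟨ ∑-cong V (λ a → trans (∑-*ˡ V (total 3) _) (cong (total 3 *_) (∑-*ˡ V (φ a) φ))) ⟩
    (∑[ a ∈ V ] total 3 * (φ a * size X))
      ≡⟨ trans (∑-*ˡ V (total 3) _) (cong (total 3 *_) (∑-*ʳ V (size X) φ)) ⟩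
    total 3 * (size X * size X)
      ∎
    where
    open ≡-Reasoning
    V = allFin n
    delete : ∀ a b xs → f (a ∷ b ∷ xs) * (φ a * φ b) ≡ f xs * (φ a * φ b)
    delete a b xs with X a in a∈ | X b in b∈
    ... | true  | true  = cong (_* 1) (f-delete xs a∈ b∈)
    ... | true  | false = trans (ℕ.*-zeroʳ (f (a ∷ b ∷ xs))) (sym (ℕ.*-zeroʳ (f xs)))
    ... | false | _     = trans (ℕ.*-zeroʳ (f (a ∷ b ∷ xs))) (sym (ℕ.*-zeroʳ (f xs)))

  four-members : ∀ {a b c d} e → AllTrue (X a) (X b) (X c) (X d) → f (a ∷ b ∷ c ∷ d ∷ e ∷ []) ≡ 0
  four-members e (a∈ , b∈ , c∈ , d∈) =
    trans (f-delete _ a∈ b∈) (trans (f-delete _ c∈ d∈) (f-single e))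

  -- If four entries lie in `X`, rotate them to the front and delete two pairs: a singleton remains,
  -- where `f` is 0. Otherwise at most three pairs count.
  pairs-bound : ∀ t → f (toList t) * (orbit adjacent t + orbit skip t) ≤ 3 * f (toList t)
  pairs-bound (a ∷ b ∷ c ∷ d ∷ e ∷ []) = [ few , vanish ∘ support ]′ (pairs≤3⊎four (X a) (X b) (X c) (X d) (X e))
    where
    F = f (a ∷ b ∷ c ∷ d ∷ e ∷ [])
    w = orbit adjacent (a ∷ b ∷ c ∷ d ∷ e ∷ []) + orbit skip (a ∷ b ∷ c ∷ d ∷ e ∷ [])
    few : w ≤ 3 → F * w ≤ 3 * F
    few w≤3 = ℕ.≤-trans (ℕ.*-monoʳ-≤ F w≤3) (ℕ.≤-reflexive (ℕ.*-comm F 3))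
    vanish : F ≡ 0 → F * w ≤ 3 * F
    vanish F≡0 = subst (λ k → k * w ≤ 3 * k) (sym F≡0) z≤n
    turn : ∀ {ys} a xs → f (xs ++ a ∷ []) ≡ ys → f (a ∷ xs) ≡ ys
    turn a xs = trans (f-↭ (∷↭∷ʳ a xs))
    support : AllTrue (X a) (X b) (X c) (X d) ⊎ AllTrue (X b) (X c) (X d) (X e) ⊎ AllTrue (X c) (X d) (X e) (X a) ⊎
              AllTrue (X d) (X e) (X a) (X b) ⊎ AllTrue (X e) (X a) (X b) (X c) → F ≡ 0
    support (inj₁ h)                      = four-members e h
    support (inj₂ (inj₁ h))               = turn a _ (four-members a h)
    support (inj₂ (inj₂ (inj₁ h)))        = turn a _ (turn b _ (four-members b h))
    support (inj₂ (inj₂ (inj₂ (inj₁ h)))) = turn a _ (turn b _ (turn c _ (four-members c h)))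
    support (inj₂ (inj₂ (inj₂ (inj₂ h)))) = turn a _ (turn b _ (turn c _ (turn d _ (four-members d h))))

  -- Double counting of 5-tuples with a marked pair of positions in `X`: each of the ten pairs
  -- contributes the same amount.
  deletion-bound : 10 * (total 3 * (size X * size X)) ≤ 3 * total 5
  deletion-bound = begin
    10 * (total 3 * (size X * size X))                    ≡⟨ cong (10 *_) weighted-adjacent ⟨
    10 * weighted adjacent                                ≡⟨ ℕ.*-distribʳ-+ (weighted adjacent) 5 5 ⟩
    5 * weighted adjacent + 5 * weighted adjacent         ≡⟨ cong (λ s → 5 * weighted adjacent + 5 * s) weighted-skip ⟨
    5 * weighted adjacent + 5 * weighted skip             ≡⟨ cong₂ _+_ (weighted-orbit adjacent) (weighted-orbit skip) ⟨
    weighted (orbit adjacent) + weighted (orbit skip)     ≡⟨ weighted-+ (orbit adjacent) (orbit skip) ⟨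
    weighted (λ t → orbit adjacent t + orbit skip t)      ≤⟨ ∑-mono (tuples n 5) pairs-bound ⟩
    ∑ (tuples n 5) (λ t → 3 * f (toList t))               ≡⟨ ∑-*ˡ (tuples n 5) 3 _ ⟩
    3 * total 5                                           ∎
    where open ℕ.≤-Reasoning

-- The lower bound

coincidences : Vec (Fin n) 3 → ℕ
coincidences (a ∷ b ∷ c ∷ []) = ⟦ does (a Fin.≟ b) ⟧ + ⟦ does (a Fin.≟ c) ⟧ + ⟦ does (b Fin.≟ c) ⟧

-- Three toggles of absent vertices give 3. A toggle of a vertex already present falls short by 2,
-- which an equal pair of entries pays for.
count-triple : ∀ (t : Vec (Fin n) 3) → 3 ≤ count (ind (toList t)) + 2 * coincidences t
count-triple {n} t@(a ∷ b ∷ c ∷ []) = begin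
  3                                          ≡⟨ cong (3 +_) (count-replicate n) ⟨
  2 + suc (count (ind {n} []))               ≡⟨ cong (2 +_) (count-flip c (ind [])) ⟨
  2 + (count (ind (c ∷ [])) + 2 * ⟦ lookup (ind []) c ⟧)
                                             ≡⟨ cong (λ k → 2 + (count (ind (c ∷ [])) + 2 * k)) (lookup-ind-[] c) ⟩
  2 + (count (ind (c ∷ [])) + 0)             ≡⟨ cong (2 +_) (ℕ.+-identityʳ _) ⟩
  1 + suc (count (ind (c ∷ [])))             ≡⟨ cong suc (count-flip b (ind (c ∷ []))) ⟨
  suc (count (ind (b ∷ c ∷ []))) + 2 * l₂    ≡⟨ cong (_+ 2 * l₂) (count-flip a (ind (b ∷ c ∷ []))) ⟨
  count (ind (a ∷ b ∷ c ∷ [])) + 2 * l₁ + 2 * l₂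
    ≤⟨ ℕ.+-mono-≤ (ℕ.+-monoʳ-≤ (count (ind (toList t))) (ℕ.*-monoʳ-≤ 2 l₁≤)) (ℕ.*-monoʳ-≤ 2 l₂≤) ⟩
  count (ind (a ∷ b ∷ c ∷ [])) + 2 * (ab + ac) + 2 * bc
    ≡⟨ solve 4 (λ x ab ac bc → x :+ con 2 :* (ab :+ ac) :+ con 2 :* bc := x :+ con 2 :* (ab :+ ac :+ bc)) refl (count (ind (toList t))) ab ac bc ⟩
  count (ind (toList t)) + 2 * coincidences t ∎
  where
  open ℕ.≤-Reasoning
  ab = ⟦ does (a Fin.≟ b) ⟧
  ac = ⟦ does (a Fin.≟ c) ⟧
  bc = ⟦ does (b Fin.≟ c) ⟧
  l₁ = ⟦ lookup (ind (b ∷ c ∷ [])) a ⟧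
  l₂ = ⟦ lookup (ind (c ∷ [])) b ⟧
  one : ∀ u w → ⟦ lookup (ind (w ∷ [])) u ⟧ ≤ ⟦ does (u Fin.≟ w) ⟧
  one u w = ℕ.≤-trans (lookup-ind-∷ u w []) (ℕ.≤-reflexive (trans (cong (⟦ does (u Fin.≟ w) ⟧ +_) (lookup-ind-[] u)) (ℕ.+-identityʳ _)))
  l₂≤ : l₂ ≤ bc
  l₂≤ = one b c
  l₁≤ : l₁ ≤ ab + ac
  l₁≤ = ℕ.≤-trans (lookup-ind-∷ a b (c ∷ [])) (ℕ.+-monoʳ-≤ ab (one a c))

∑-coincidences : ∀ n → ∑ (tuples n 3) coincidences ≡ 3 * (n * n)
∑-coincidences n = begin
  ∑ (tuples n 3) coincidences
    ≡⟨ unfold coincidences ⟩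
  (∑[ a ∈ V ] ∑[ b ∈ V ] ∑[ c ∈ V ] (a ≟₁ b + a ≟₁ c + b ≟₁ c))
    ≡⟨ ∑-cong V (λ a → trans (∑-cong V (inner a)) (middle a)) ⟩
  (∑[ a ∈ V ] (3 * n))
    ≡⟨ constant (3 * n) ⟩
  n * (3 * n)
    ≡⟨ solve 1 (λ n → n :* (con 3 :* n) := con 3 :* (n :* n)) refl n ⟩
  3 * (n * n)
    ∎
  where
  open ≡-Reasoning
  V = allFin n
  _≟₁_ : Fin n → Fin n → ℕ
  a ≟₁ b = ⟦ does (a Fin.≟ b) ⟧
  infix 8 _≟₁_
  unfold : ∀ g → ∑ (tuples n 3) g ≡ ∑[ a ∈ V ] ∑[ b ∈ V ] ∑[ c ∈ V ] g (a ∷ b ∷ c ∷ [])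
  unfold g = trans (∑-tuples-suc n 2 g) (∑-cong V λ a → trans (∑-tuples-suc n 1 _) (∑-cong V λ b →
    trans (∑-tuples-suc n 0 _) (∑-cong V λ c → ℕ.+-identityʳ _)))
  constant : ∀ k → ∑ V (λ _ → k) ≡ n * k
  constant k = trans (∑-const V k) (cong (_* k) (length-allFin n))
  inner : ∀ a b → ∑[ c ∈ V ] (a ≟₁ b + a ≟₁ c + b ≟₁ c) ≡ a ≟₁ b * n + 2
  inner a b = begin
    ∑ V (λ c → a ≟₁ b + a ≟₁ c + b ≟₁ c)                ≡⟨ ∑-+ V _ (b ≟₁_) ⟩
    ∑ V (λ c → a ≟₁ b + a ≟₁ c) + ∑ V (b ≟₁_)           ≡⟨ cong₂ _+_ (∑-+ V _ (a ≟₁_)) (∑-≟ b) ⟩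
    ∑ V (λ c → a ≟₁ b) + ∑ V (a ≟₁_) + 1                ≡⟨ cong₂ (λ x y → x + y + 1) (trans (constant (a ≟₁ b)) (ℕ.*-comm n _)) (∑-≟ a) ⟩
    a ≟₁ b * n + 1 + 1                                  ≡⟨ ℕ.+-assoc _ 1 1 ⟩
    a ≟₁ b * n + 2                                      ∎
  middle : ∀ a → ∑[ b ∈ V ] (a ≟₁ b * n + 2) ≡ 3 * n
  middle a = begin
    ∑ V (λ b → a ≟₁ b * n + 2)              ≡⟨ ∑-+ V _ _ ⟩
    ∑ V (λ b → a ≟₁ b * n) + ∑ V (λ _ → 2)  ≡⟨ cong₂ _+_ (trans (∑-*ʳ V n (a ≟₁_)) (cong (_* n) (∑-≟ a))) (constant 2) ⟩
    1 * n + n * 2                           ≡⟨ solve 1 (λ n → con 1 :* n :+ n :* con 2 := con 3 :* n) refl n ⟩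
    3 * n                                   ∎

-- For n ≥ 96 the defect 6 n² in the count of triples is at most n³ / 16.
totals-bound : ∀ n K P s S₃ S₅ → 96 ≤ n → 0 < K →
  32 * (n * n) * S₃ * P ≤ 15 * S₅ * P + s * (32 * (n * n) * (n ^ 3 * K)) →
  S₅ ≤ n ^ 5 * (4 * K) →
  n ^ 3 * (2 * K) ≤ S₃ + 2 * (3 * (n * n)) * K →
  P ≤ 16 * s
totals-bound n K P s S₃ S₅ 96≤n 0<K upper₃ upper₅ lower₃ =
  ℕ.*-cancelˡ-≤ D (ℕ.+-cancelˡ-≤ (62 * (n ^ 5 * K * P)) _ _ (begin
    -- Of the 64 = 32 · 2 copies of `n ^ 5 * K * P` from the triples, 60 = 15 · 4 go to the 5-tuples
    -- and 2 to the defect. The remaining 2 face the 32 that multiply `s`, whence the factor 16.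
    62 * (n ^ 5 * K * P) + D * P
      ≡⟨ solve 3 (λ n K P → con 62 :* (n^5 n :* K :* P) :+ con 2 :* (n^5 n :* K) :* P
                         := con 32 :* (n :* n) :* P :* (n^3 n :* (con 2 :* K))) refl n K P ⟩
    32 * (n * n) * P * (n ^ 3 * (2 * K))
      ≤⟨ ℕ.*-monoʳ-≤ (32 * (n * n) * P) lower₃ ⟩
    32 * (n * n) * P * (S₃ + 2 * (3 * (n * n)) * K)
      ≡⟨ solve 4 (λ n K P S → con 32 :* (n :* n) :* P :* (S :+ con 2 :* (con 3 :* (n :* n)) :* K)
                           := con 32 :* (n :* n) :* S :* P :+ con 96 :* (con 2 :* (n :* n :* n :* n :* K :* P))) refl n K P S₃ ⟩
    32 * (n * n) * S₃ * P + 96 * X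
      ≤⟨ ℕ.+-mono-≤ upper₃ (ℕ.*-monoˡ-≤ X 96≤n) ⟩
    15 * S₅ * P + s * (32 * (n * n) * (n ^ 3 * K)) + n * X
      ≤⟨ ℕ.+-monoˡ-≤ (n * X) (ℕ.+-monoˡ-≤ (s * (32 * (n * n) * (n ^ 3 * K))) (ℕ.*-monoˡ-≤ P (ℕ.*-monoʳ-≤ 15 upper₅))) ⟩
    15 * (n ^ 5 * (4 * K)) * P + s * (32 * (n * n) * (n ^ 3 * K)) + n * X
      ≡⟨ solve 4 (λ n K P s → con 15 :* (n^5 n :* (con 4 :* K)) :* P :+ s :* (con 32 :* (n :* n) :* (n^3 n :* K))
                                :+ n :* (con 2 :* (n :* n :* n :* n :* K :* P))
                           := con 62 :* (n^5 n :* K :* P) :+ con 2 :* (n^5 n :* K) :* (con 16 :* s)) refl n K P s ⟩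
    62 * (n ^ 5 * K * P) + D * (16 * s) ∎))
  where
  open ℕ.≤-Reasoning
  n^3 n^5 : ∀ {k} → Polynomial k → Polynomial k
  n^3 n = n :* (n :* (n :* con 1))
  n^5 n = n :* (n :* n^3 n)
  X D : ℕ
  X = 2 * (n * n * n * n * K * P)
  D = 2 * (n ^ 5 * K)
  instance
    n≢0 : NonZero n
    n≢0 = >-nonZero (ℕ.≤-trans (s≤s z≤n) 96≤n)
    K≢0 : NonZero K
    K≢0 = >-nonZero 0<K
    n^5≢0 : NonZero (n ^ 5)
    n^5≢0 = ℕ.m^n≢0 n 5
    n^5K≢0 : NonZero (n ^ 5 * K)
    n^5K≢0 = ℕ.m*n≢0 (n ^ 5) K
    D≢0 : NonZero D
    D≢0 = ℕ.m*n≢0 2 (n ^ 5 * K)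

module LowerBound {n : ℕ} (G : Graph n)
  (expansion : ∀ X → 2 * ∣ X ∣ ≤ n → 10 * ∣ X ∣ ≤ length (δ G X))
  (R : SubCubeSumsRefutation (Tseitin G (λ _ → true))) (96≤n : 96 ≤ n) where
  open Graph G
  open Counting G
  open Linking G
  open Giant G expansion
  open SubCubeSumsRefutation R renaming (size to |R|)

  0<n : 0 < n
  0<n = ℕ.≤-trans (s≤s z≤n) 96≤n

  width-[] : width {#E} [] ≡ 0
  width-[] = trans (∑-const (allFin #E) 0) (ℕ.*-zeroʳ (length (allFin #E)))

  -- The empty clause has width 0, so `cosmall` leaves no vertex outside its giant class.
  all-linked : ∀ u v → Linked [] u v
  all-linked u v = linked u v (everywhere u) (everywhere v)
    where
    open GiantClass (giantClass [] (subst (_< 2 * n) (sym width-[]) (ℕ.*-mono-< {0} {2} {0} {n} (s≤s z≤n) 0<n)))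
    everywhere : ∀ u → member u ≡ true
    everywhere u with member u in eq
    ... | true  = refl
    ... | false = contradiction (begin
      1                        ≡⟨ cong (⟦_⟧ ∘ not) eq ⟨
      ⟦ not (member u) ⟧       ≤⟨ ∑-∈ (λ w → ⟦ not (member w) ⟧) (∈-allFin u) ⟩
      size (not ∘ member)      ≤⟨ ℕ.m≤n*m (size (not ∘ member)) 10 ⟩
      10 * size (not ∘ member) ≤⟨ cosmall ⟩
      width {#E} []            ≡⟨ width-[] ⟩
      0                        ∎) λ ()
      where open ℕ.≤-Reasoning

  root : Fin n
  root = fromℕ< 0<n

  K : ℕ
  K = N [] (ind (root ∷ []))

  N-[]-single : ∀ u → N [] (ind (u ∷ [])) ≡ K
  N-[]-single u = all-linked u root (ind [])

  -- In `∑-N` at the empty set the right side is 0, so both summands on the left vanish.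
  N-[]-zero : N [] (ind []) ≡ 0
  N-[]-zero = ℕ.m+n≡0⇒n≡0 _ (trans (∑-N R (ind [])) (cong (_* N [] (ind [])) (count-replicate n)))

  -- Deleting linked pairs ends at the empty list or at a singleton.
  N-ind≤K : ∀ xs → N [] (ind xs) ≤ K
  N-ind≤K []           = ℕ.≤-trans (ℕ.≤-reflexive N-[]-zero) z≤n
  N-ind≤K (x ∷ [])     = ℕ.≤-reflexive (N-[]-single x)
  N-ind≤K (x ∷ y ∷ xs) = ℕ.≤-trans (ℕ.≤-reflexive (linked-pair {[]} (all-linked x y) (ind xs))) (N-ind≤K xs)

  N≤K : ∀ U → N [] U ≤ K
  N≤K U = let xs , eq = ind-surjective U in subst (λ U → N [] U ≤ K) eq (N-ind≤K xs)

  2^#E≤ : 2 ^ #E ≤ 2 ^ n * K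
  2^#E≤ = begin
    2 ^ #E
      ≡⟨ ℕ.*-identityʳ _ ⟨
    2 ^ #E * 1
      ≡⟨ ∑-allVecs-const #E 1 ⟨
    ∑ (allVecs #E) (λ _ → 1)
      ≤⟨ ∑-mono (allVecs #E) (λ v → ℕ.≤-trans (ℕ.≤-reflexive (sym (cong (λ b → ⟦ b ⟧ * 1) (dec-true (violated v ≟ⱽ violated v) refl))))
           (∑-∈ (λ U → ⟦ does (violated v ≟ⱽ U) ⟧ * 1) (∈-allVecs (violated v)))) ⟩
    (∑[ v ∈ allVecs #E ] ∑[ U ∈ allVecs n ] (⟦ does (violated v ≟ⱽ U) ⟧ * 1))
      ≡⟨ ∑-swap (allVecs #E) (allVecs n) _ ⟩
    ∑ (allVecs n) (N [])
      ≤⟨ ∑-mono (allVecs n) N≤K ⟩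
    ∑ (allVecs n) (λ _ → K)
      ≡⟨ ∑-allVecs-const n K ⟩
    2 ^ n * K
      ∎
    where open ℕ.≤-Reasoning

  0<K : 0 < K
  0<K with K | 2^#E≤
  ... | zero  | le = contradiction (ℕ.≤-trans (ℕ.m^n>0 2 #E) (ℕ.≤-trans le (ℕ.≤-reflexive (ℕ.*-zeroʳ (2 ^ n))))) λ ()
  ... | suc _ | _  = s≤s z≤n

  -- Width 2n costs a factor 2²ⁿ of the 2^#E assignments, and `2^#E≤` gives back only 2ⁿ.
  N-wide : ∀ C U → 2 * n ≤ width C → N C U * 2 ^ n ≤ K
  N-wide C U wide = ℕ.*-cancelˡ-≤ (2 ^ n) {{ℕ.m^n≢0 2 n}} (begin
    2 ^ n * (N C U * 2 ^ n) ≡⟨ solve 2 (λ p k → p :* (k :* p) := k :* (p :* p)) refl (2 ^ n) (N C U) ⟩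
    N C U * (2 ^ n * 2 ^ n) ≡⟨ cong (N C U *_) (ℕ.^-distribˡ-+-* 2 n n) ⟨
    N C U * 2 ^ (n + n)     ≡⟨ cong (λ k → N C U * 2 ^ (n + k)) (ℕ.+-identityʳ n) ⟨
    N C U * 2 ^ (2 * n)     ≤⟨ ℕ.*-monoʳ-≤ (N C U) (ℕ.^-monoʳ-≤ 2 wide) ⟩
    N C U * 2 ^ width C     ≤⟨ N-width C U ⟩
    2 ^ #E                  ≤⟨ 2^#E≤ ⟩
    2 ^ n * K               ∎)
    where
    open ℕ.≤-Reasoning

  -- With at most one violated vertex, `∑-N` leaves nothing for the clauses of the refutation.
  N-single : ∀ {C} → C ∈ clauses → ∀ u → N C (ind (u ∷ [])) ≡ 0
  N-single {C} C∈ u = ℕ.n≤0⇒n≡0 (ℕ.≤-trans (∑-∈ (λ C → N C U) C∈) (ℕ.+-cancelʳ-≤ (N [] U) _ 0 (begin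
    ∑ clauses (λ C → N C U) + N [] U ≡⟨ ∑-N R U ⟩
    count U * N [] U                 ≤⟨ ℕ.*-monoˡ-≤ (N [] U) (count-ind (u ∷ [])) ⟩
    1 * N [] U                       ≡⟨ ℕ.*-identityˡ _ ⟩
    N [] U                           ∎)))
    where
    open ℕ.≤-Reasoning
    U = ind (u ∷ [])

  ∑-N-quintuple : ∀ (t : Vec (Fin n) 5) → ∑ clauses (λ C → N C (ind (toList t))) ≤ 4 * K
  ∑-N-quintuple t@(_ ∷ _ ∷ _ ∷ _ ∷ _ ∷ []) = ℕ.≤-trans (ℕ.+-cancelʳ-≤ (N [] U) _ _ (begin
    ∑ clauses (λ C → N C U) + N [] U ≡⟨ ∑-N R U ⟩
    count U * N [] U                 ≤⟨ ℕ.*-monoˡ-≤ (N [] U) (count-ind (toList t)) ⟩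
    5 * N [] U                       ≡⟨ ℕ.+-comm (N [] U) _ ⟩
    4 * N [] U + N [] U              ∎)) (ℕ.*-monoʳ-≤ 4 (N≤K U))
    where
    open ℕ.≤-Reasoning
    U = ind (toList t)

  -- Three distinct vertices give exactly `2 * K`; the second summand compensates for repeated
  -- entries.
  ∑-N-triple : ∀ (t : Vec (Fin n) 3) → 2 * K ≤ ∑ clauses (λ C → N C (ind (toList t))) + 2 * coincidences t * K
  ∑-N-triple t@(a ∷ b ∷ c ∷ []) = ℕ.+-cancelʳ-≤ K _ _ (begin
    2 * K + K                                    ≡⟨ ℕ.+-comm (2 * K) K ⟩
    3 * K                                        ≤⟨ ℕ.*-monoˡ-≤ K (count-triple t) ⟩
    (count U + 2 * coincidences t) * K           ≡⟨ ℕ.*-distribʳ-+ K (count U) _ ⟩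
    count U * K + 2 * coincidences t * K         ≡⟨ cong (λ k → count U * k + 2 * coincidences t * K) N≡K ⟨
    count U * N [] U + 2 * coincidences t * K    ≡⟨ cong (_+ 2 * coincidences t * K) (∑-N R U) ⟨
    S + N [] U + 2 * coincidences t * K          ≡⟨ cong (λ k → S + k + 2 * coincidences t * K) N≡K ⟩
    S + K + 2 * coincidences t * K               ≡⟨ solve 3 (λ s k d → s :+ k :+ d := s :+ d :+ k) refl S K (2 * coincidences t * K) ⟩
    S + 2 * coincidences t * K + K               ∎)
    where
    open ℕ.≤-Reasoning
    U = ind (toList t)
    S = ∑ clauses (λ C → N C U)
    N≡K : N [] U ≡ K
    N≡K = trans (linked-pair {[]} (all-linked a b) (ind (c ∷ []))) (N-[]-single c)

  total : ℕ → Clause #E → ℕ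
  total k C = ∑[ t ∈ tuples n k ] N C (ind (toList t))

  -- Put k ≥ 4n/5 into `deletion-bound`: 10 · 16/25 = 32/5, and multiplying by 5 clears the
  -- fraction.
  total-narrow : ∀ {C} → C ∈ clauses → width C < 2 * n → 32 * (n * n) * total 3 C ≤ 15 * total 5 C
  total-narrow {C} C∈ narrow = begin
    32 * (n * n) * T₃                ≡⟨ solve 2 (λ n t → con 32 :* (n :* n) :* t := con 2 :* t :* (con 4 :* n :* (con 4 :* n))) refl n T₃ ⟩
    2 * T₃ * (4 * n * (4 * n))       ≤⟨ ℕ.*-monoʳ-≤ (2 * T₃) (ℕ.*-mono-≤ 4n≤5k 4n≤5k) ⟩
    2 * T₃ * (5 * k * (5 * k))       ≡⟨ solve 2 (λ k t → con 2 :* t :* (con 5 :* k :* (con 5 :* k)) := con 5 :* (con 10 :* (t :* (k :* k)))) refl k T₃ ⟩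
    5 * (10 * (T₃ * (k * k)))        ≤⟨ ℕ.*-monoʳ-≤ 5 deletion-bound ⟩
    5 * (3 * total 5 C)             ≡⟨ ℕ.*-assoc 5 3 (total 5 C) ⟨
    15 * total 5 C                  ∎
    where
    open ℕ.≤-Reasoning
    open GiantClass (giantClass C narrow)
    T₃ = total 3 C
    k = size member
    j = size (not ∘ member)
    5j≤n : 5 * j ≤ n
    5j≤n = ℕ.*-cancelˡ-≤ 2 (begin
      2 * (5 * j) ≡⟨ ℕ.*-assoc 2 5 j ⟨
      10 * j      ≤⟨ cosmall ⟩
      width C     ≤⟨ ℕ.<⇒≤ narrow ⟩
      2 * n       ∎)
    4n≤5k : 4 * n ≤ 5 * k
    4n≤5k = ℕ.+-cancelʳ-≤ (5 * j) _ _ (begin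
      4 * n + 5 * j ≤⟨ ℕ.+-monoʳ-≤ (4 * n) 5j≤n ⟩
      4 * n + n     ≡⟨ ℕ.+-comm (4 * n) n ⟩
      5 * n         ≡⟨ cong (5 *_) (size-not member) ⟨
      5 * (k + j)   ≡⟨ ℕ.*-distribˡ-+ 5 k j ⟩
      5 * k + 5 * j ∎)
    open PairDeletion (λ xs → N C (ind xs)) member
      (λ p → cong (N C) (ind-↭ p))
      (λ xs a∈ b∈ → linked-pair {C} (linked _ _ a∈ b∈) (ind xs))
      (N-single C∈)
      using (deletion-bound)

  total-wide : ∀ C → 2 * n ≤ width C → total 3 C * 2 ^ n ≤ n ^ 3 * K
  total-wide C wide = begin
    total 3 C * 2 ^ n                                      ≡⟨ ∑-*ʳ (tuples n 3) (2 ^ n) _ ⟨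
    ∑ (tuples n 3) (λ t → N C (ind (toList t)) * 2 ^ n)    ≤⟨ ∑-mono (tuples n 3) (λ t → N-wide C (ind (toList t)) wide) ⟩
    ∑ (tuples n 3) (λ _ → K)                               ≡⟨ ∑-tuples-const n 3 K ⟩
    n ^ 3 * K                                              ∎
    where open ℕ.≤-Reasoning

  -- One inequality for narrow and wide clauses alike, ready to be summed: the last term is the
  -- allowance for a wide one.
  total-bound : ∀ C → C ∈ clauses →
    32 * (n * n) * total 3 C * 2 ^ n ≤ 15 * total 5 C * 2 ^ n + 32 * (n * n) * (n ^ 3 * K)
  total-bound C C∈ with width C ℕ.<? 2 * n
  ... | yes narrow = ℕ.≤-trans (ℕ.*-monoˡ-≤ (2 ^ n) (total-narrow C∈ narrow)) (ℕ.m≤m+n _ _)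
  ... | no ¬narrow = begin
    32 * (n * n) * total 3 C * 2 ^ n   ≡⟨ ℕ.*-assoc (32 * (n * n)) _ _ ⟩
    32 * (n * n) * (total 3 C * 2 ^ n) ≤⟨ ℕ.*-monoʳ-≤ (32 * (n * n)) (total-wide C (ℕ.≮⇒≥ ¬narrow)) ⟩
    32 * (n * n) * (n ^ 3 * K)         ≤⟨ ℕ.m≤n+m _ _ ⟩
    15 * total 5 C * 2 ^ n + 32 * (n * n) * (n ^ 3 * K) ∎
    where open ℕ.≤-Reasoning

  ∑-total : ∀ k → ∑ clauses (total k) ≡ ∑[ t ∈ tuples n k ] ∑[ C ∈ clauses ] N C (ind (toList t))
  ∑-total k = ∑-swap clauses (tuples n k) _

  2^n≤16|R| : 2 ^ n ≤ 16 * |R|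
  2^n≤16|R| = totals-bound n K (2 ^ n) |R| (∑ clauses (total 3)) (∑ clauses (total 5)) 96≤n 0<K upper₃ upper₅ lower₃
    where
    open ℕ.≤-Reasoning
    M = 32 * (n * n)
    upper₃ : M * ∑ clauses (total 3) * 2 ^ n ≤ 15 * ∑ clauses (total 5) * 2 ^ n + |R| * (M * (n ^ 3 * K))
    upper₃ = begin
      M * ∑ clauses (total 3) * 2 ^ n
        ≡⟨ cong (_* 2 ^ n) (∑-*ˡ clauses M (total 3)) ⟨
      ∑ clauses (λ C → M * total 3 C) * 2 ^ n
        ≡⟨ ∑-*ʳ clauses (2 ^ n) _ ⟨
      ∑ clauses (λ C → M * total 3 C * 2 ^ n)
        ≤⟨ ∑-mono-∈ clauses total-bound ⟩
      ∑ clauses (λ C → 15 * total 5 C * 2 ^ n + M * (n ^ 3 * K))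
        ≡⟨ ∑-+ clauses _ _ ⟩
      ∑ clauses (λ C → 15 * total 5 C * 2 ^ n) + ∑ clauses (λ _ → M * (n ^ 3 * K))
        ≡⟨ cong₂ _+_ (trans (∑-*ʳ clauses (2 ^ n) _) (cong (_* 2 ^ n) (∑-*ˡ clauses 15 (total 5)))) (∑-const clauses _) ⟩
      15 * ∑ clauses (total 5) * 2 ^ n + |R| * (M * (n ^ 3 * K))
        ∎
    upper₅ : ∑ clauses (total 5) ≤ n ^ 5 * (4 * K)
    upper₅ = begin
      ∑ clauses (total 5)                                                      ≡⟨ ∑-total 5 ⟩
      (∑[ t ∈ tuples n 5 ] ∑[ C ∈ clauses ] N C (ind (toList t)))              ≤⟨ ∑-mono (tuples n 5) ∑-N-quintuple ⟩
      ∑ (tuples n 5) (λ _ → 4 * K)                                             ≡⟨ ∑-tuples-const n 5 (4 * K) ⟩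
      n ^ 5 * (4 * K)                                                          ∎
    lower₃ : n ^ 3 * (2 * K) ≤ ∑ clauses (total 3) + 2 * (3 * (n * n)) * K
    lower₃ = begin
      n ^ 3 * (2 * K)
        ≡⟨ ∑-tuples-const n 3 (2 * K) ⟨
      ∑ (tuples n 3) (λ _ → 2 * K)
        ≤⟨ ∑-mono (tuples n 3) ∑-N-triple ⟩
      ∑ (tuples n 3) (λ t → ∑ clauses (λ C → N C (ind (toList t))) + 2 * coincidences t * K)
        ≡⟨ ∑-+ (tuples n 3) _ _ ⟩
      ∑ (tuples n 3) (λ t → ∑ clauses (λ C → N C (ind (toList t)))) + ∑ (tuples n 3) (λ t → 2 * coincidences t * K)
        ≡⟨ cong₂ _+_ (sym (∑-total 3)) (trans (∑-*ʳ (tuples n 3) K _)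
             (cong (_* K) (trans (∑-*ˡ (tuples n 3) 2 coincidences) (cong (2 *_) (∑-coincidences n))))) ⟩
      ∑ clauses (total 3) + 2 * (3 * (n * n)) * K
        ∎

-- From the counting bound to the exponential bound

2^n≤s² : ∀ n s → 8 ≤ n → 2 ^ n ≤ 16 * s → 2 ^ n ≤ s ^ 2
2^n≤s² n s 8≤n le = ℕ.*-cancelˡ-≤ (2 ^ n) {{ℕ.m^n≢0 2 n}} (begin
  2 ^ n * 2 ^ n       ≤⟨ ℕ.*-mono-≤ le le ⟩
  16 * s * (16 * s)   ≡⟨ solve 1 (λ s → con 16 :* s :* (con 16 :* s) := con 256 :* (s :* (s :* con 1))) refl s ⟩
  -- The constant 16² = 2⁸ is absorbed by one of the two factors 2ⁿ.
  2 ^ 8 * s ^ 2       ≤⟨ ℕ.*-monoˡ-≤ (s ^ 2) (ℕ.^-monoʳ-≤ 2 8≤n) ⟩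
  2 ^ n * s ^ 2       ∎)
  where
  open ℕ.≤-Reasoning

-- Opened this late because +_ makes sections such as (k +_) ambiguous.
open import Data.Integer using (+_)

-- A normalised fraction `+ k / 1` does not compute for a variable `k`, so the comparison passes to
-- unnormalised fractions with denominator 1.
drop-/1 : ∀ q k l → (+ q / 1) *ℚ (+ k / 1) ≤ℚ (+ l / 1) → q * k ≤ l
drop-/1 q k l le = ℤ.drop‿+≤+ (begin
  + (q * k)           ≡⟨ ℤ.pos-* q k ⟩
  + q ℤ.* + k         ≡⟨ ℤ.*-identityʳ _ ⟨
  + q ℤ.* + k ℤ.* + 1 ≤⟨ ℚᵘ.drop-*≤* leᵘ ⟩
  + l ℤ.* + 1         ≡⟨ ℤ.*-identityʳ (+ l) ⟩
  + l                 ∎)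
  where
  open ℤ.≤-Reasoning
  leᵘ : ℚᵘ.mkℚᵘ (+ q) 0 ℚᵘ.* ℚᵘ.mkℚᵘ (+ k) 0 ℚᵘ.≤ ℚᵘ.mkℚᵘ (+ l) 0
  leᵘ = ℚᵘ.≤-trans (ℚᵘ.≤-reflexive (ℚᵘ.≃-sym (ℚᵘ.≃-trans (ℚ.toℚᵘ-homo-* (+ q / 1) (+ k / 1))
          (ℚᵘ.*-cong (ℚ.toℚᵘ-fromℚᵘ (ℚᵘ.mkℚᵘ (+ q) 0)) (ℚ.toℚᵘ-fromℚᵘ (ℚᵘ.mkℚᵘ (+ k) 0))))))
        (ℚᵘ.≤-trans (ℚ.toℚᵘ-mono-≤ le) (ℚᵘ.≤-reflexive (ℚ.toℚᵘ-fromℚᵘ (ℚᵘ.mkℚᵘ (+ l) 0))))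

theorem4p9 : (c : ℝ) (d : ℕ) → (+ 10 / 1) <ℝ c →
    ∃[ ε ] Positive ε × (∃[ n₀ ] (∀ (n : ℕ) → n ≥ n₀ → n % 2 ≡ 1 →
    (G : Graph n) → Regular G d → Expander G c →
    (R : SubCubeSumsRefutation (Tseitin G (λ _ → true))) →
    2^[ ε · n ]≤ SubCubeSumsRefutation.size R))
-- For ε = 1/2 the goal is `2 ^ (1 * n) ≤ |R| ^ 2`, and 96 is the threshold of `totals-bound`. As 10
-- lies in the lower cut of `c`, the expansion inequality can be read at the rational 10.
theorem4p9 c d 10<c = + 1 / 2 , _ , 96 , λ n 96≤n _ G _ expander R →
  let expansion X small = drop-/1 10 ∣ X ∣ (length (δ G X)) (expander X small (+ 10 / 1) 10<c)
      |R| = SubCubeSumsRefutation.size R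
  in subst (λ k → 2 ^ k ≤ |R| ^ 2) (sym (ℕ.*-identityˡ n))
       (2^n≤s² n |R| (ℕ.≤-trans (ℕ.m≤m+n 8 88) 96≤n) (LowerBound.2^n≤16|R| G expansion R 96≤n))
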